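{- (Decomposition.) Let $\Delta$ be any derivation in $\mathsf{SNEL}$ from $T$ to $R$. Then there exist derivations from $T$ to $R$ of each of the following four shapes (for some intermediate structures): (1) $T\xrightarrow{\{\mathsf{e}\downarrow\}}P_1\xrightarrow{\{\mathsf{g}\uparrow\}}P_2\xrightarrow{\{\mathsf{b}\uparrow\}}P_3\xrightarrow{\{\mathsf{ai}\downarrow\}}P_4\xrightarrow{\{\mathsf{w}\downarrow\}}P_5\xrightarrow{\mathsf{SNELh}}Q_5\xrightarrow{\{\mathsf{w}\uparrow\}}Q_4\xrightarrow{\{\mathsf{ai}\uparrow\}}Q_3\xrightarrow{\{\mathsf{b}\downarrow\}}Q_2\xrightarrow{\{\mathsf{g}\downarrow\}}Q_1\xrightarrow{\{\mathsf{e}\uparrow\}}R$; (2) $T\xrightarrow{\{\mathsf{g}\uparrow\}}U_1\xrightarrow{\{\mathsf{b}\uparrow\}}U_2\xrightarrow{\{\mathsf{e}\downarrow\}}U_3\xrightarrow{\{\mathsf{w}\downarrow\}}U_4\xrightarrow{\{\mathsf{ai}\downarrow\}}U_5\xrightarrow{\mathsf{SNELh}}V_5\xrightarrow{\{\mathsf{ai}\uparrow\}}V_4\xrightarrow{\{\mathsf{w}\uparrow\}}V_3\xrightarrow{\{\mathsf{e}\uparrow\}}V_2\xrightarrow{\{\mathsf{b}\downarrow\}}V_1\xrightarrow{\{\mathsf{g}\downarrow\}}R$; (3) $T\xrightarrow{\{\mathsf{e}\downarrow\}}W_1\xrightarrow{\{\mathsf{g}\uparrow\}}W_2\xrightarrow{\{\mathsf{b}\uparrow\}}W_3\xrightarrow{\{\mathsf{w}\uparrow\}}W_4\xrightarrow{\{\mathsf{ai}\downarrow\}}W_5\xrightarrow{\mathsf{SNELh}}Z_5\xrightarrow{\{\mathsf{ai}\uparrow\}}Z_4\xrightarrow{\{\mathsf{w}\downarrow\}}Z_3\xrightarrow{\{\mathsf{b}\downarrow\}}Z_2\xrightarrow{\{\mathsf{g}\downarrow\}}Z_1\xrightarrow{\{\mathsf{e}\uparrow\}}R$;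 (4) $T\xrightarrow{\{\mathsf{g}\uparrow\}}T_1\xrightarrow{\{\mathsf{b}\uparrow\}}T_2\xrightarrow{\{\mathsf{w}\uparrow\}}T_3\xrightarrow{\{\mathsf{e}\downarrow\}}T_4\xrightarrow{\{\mathsf{ai}\downarrow\}}T_5\xrightarrow{\mathsf{SNELh}}R_5\xrightarrow{\{\mathsf{ai}\uparrow\}}R_4\xrightarrow{\{\mathsf{e}\uparrow\}}R_3\xrightarrow{\{\mathsf{w}\downarrow\}}R_2\xrightarrow{\{\mathsf{b}\downarrow\}}R_1\xrightarrow{\{\mathsf{g}\downarrow\}}R$.
   Context: Atoms: countably many atoms $a,b,\dots$, each atom $a$ having a dual atom $\bar a$ with $\bar{\bar a}=a$. Structures are generated by $S::= a\mid \circ \mid [S,\dots,S]\mid (S,\dots,S)\mid \langle S;\dots;S\rangle \mid ?S\mid !S\mid \bar S$, where par $[\,]$, tensor $(\,)$ and seq $\langle\,\rangle$ take at least one argument, and the unit $\circ$ is not an atom. Structures are identified modulo the least congruence $=$ such that: par, tensor, seq are associative (nested brackets of the same kind flatten); par and tensor are commutative (seq is not); $\circ$ is a unit for par, tensor and seq (on either side for seq); $[R]=(R)=\langle R\rangle=R$; $\bar\circ=\circ$, $\overline{[R_1,\dots,R_h]}=(\bar R_1,\dots,\bar R_h)$, $\overline{(R_1,\dots,R_h)}=[\bar R_1,\dots,\bar R_h]$, $\overline{\langle R_1;\dots;R_h\rangle}=\langle\bar R_1;\dots;\bar R_h\rangle$, $\overline{?R}=!\bar R$, $\overline{!R}=?\bar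 R$, $\bar{\bar R}=R$. A context $S\{\;\}$ is a structure with one hole not in the scope of a negation; $S\{R\}$ is the result of filling it with $R$; $S[R,T]$ abbreviates $S\{[R,T]\}$, etc. A derivation in a set $\mathcal X$ of rules is a finite vertical chain of instances of rules of $\mathcal X$, the conclusion of each instance equal (modulo $=$) to the premise of the next one below; it may consist of a single structure. Its top structure is its premise, its bottom structure its conclusion; "from $T$ to $R$" means premise $T$, conclusion $R$. System $\mathsf{SNEL}$ has the rules (premise $\Rightarrow$ conclusion, for any context $S$, structures $R,T,U,V$, atom $a$): $\mathsf{ai}\downarrow$: $S\{\circ\}\Rightarrow S[a,\bar a]$; $\mathsf{ai}\uparrow$: $S(a,\bar a)\Rightarrow S\{\circ\}$; $\mathsf{s}$: $S([R,U],T)\Rightarrow S[(R,T),U]$; $\mathsf{q}\downarrow$: $S\langle[R,U];[T,V]\rangle\Rightarrow S[\langle R;T\rangle,\langle U;V\rangle]$; $\mathsf{q}\uparrow$: $S(\langle R;U\rangle,\langle T;V\rangle)\Rightarrow S\langle(R,T);(U,V)\rangle$; $\mathsf{p}\downarrow$: $S\{![R,T]\}\Rightarrow S[!R,?T]$; $\mathsf{p}\uparrow$: $S(?R,!T)\Rightarrow S\{?(R,T)\}$; $\mathsf{e}\downarrow$: $S\{\circ\}\Rightarrow S\{!\circ\}$; $\mathsf{e}\uparrow$: $S\{?\circ\}\Rightarrow S\{\circ\}$; $\mathsf{w}\downarrow$: $S\{\circ\}\Rightarrow S\{?R\}$; $\mathsf{w}\uparrow$: $S\{!R\}\Rightarrow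 S\{\circ\}$; $\mathsf{b}\downarrow$: $S[?R,R]\Rightarrow S\{?R\}$; $\mathsf{b}\uparrow$: $S\{!R\}\Rightarrow S(!R,R)$; $\mathsf{g}\downarrow$: $S\{??R\}\Rightarrow S\{?R\}$; $\mathsf{g}\uparrow$: $S\{!R\}\Rightarrow S\{!!R\}$. $\mathsf{SNELh}=\{\mathsf{s},\mathsf{q}\downarrow,\mathsf{q}\uparrow,\mathsf{p}\downarrow,\mathsf{p}\uparrow\}$. Notation $X_0\xrightarrow{\mathcal X_1}X_1\xrightarrow{\mathcal X_2}\cdots\xrightarrow{\mathcal X_k}X_k$ denotes a derivation from $X_0$ to $X_k$ obtained by stacking, for each $i$, a derivation from $X_{i-1}$ to $X_i$ using only rules of $\mathcal X_i$ (possibly with no rule instance). -}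

module Defs where

open import Data.Nat using (ℕ)
open import Data.Bool using (Bool; not)
open import Data.Product using (Σ; _×_; _,_)
open import Data.List using (List; []; _∷_)
open import Data.Unit using (⊤)
open import Relation.Binary.PropositionalEquality using (_≡_)

-- Atoms: countably many, each with a dual (ā), with dual (dual a) = a.
-- An atom is a name (ℕ) together with a polarity.

Atom : Set
Atom = ℕ × Bool

dual : Atom → Atom
dual (n , b) = (n , not b)

-- Raw structures.  The n-ary par/tensor/seq (h ≥ 1 arguments) are
-- represented by binary constructors; by associativity and [R]=(R)=⟨R⟩=R
-- this yields exactly the same equivalence classes.

data Str : Set where
  at   : Atom → Str
  unit : Str
  par  : Str → Str → Str
  ten  : Str → Str → Str
  seq  : Str → Str → Str
  wn   : Str → Str
  oc   : Str → Str
  neg  : Str → Str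

infix 4 _≃_
data _≃_ : Str → Str → Set where
  ≃-refl  : ∀ {R} → R ≃ R
  ≃-sym   : ∀ {R T} → R ≃ T → T ≃ R
  ≃-trans : ∀ {R T U} → R ≃ T → T ≃ U → R ≃ U
  par-cong : ∀ {R R' T T'} → R ≃ R' → T ≃ T' → par R T ≃ par R' T'
  ten-cong : ∀ {R R' T T'} → R ≃ R' → T ≃ T' → ten R T ≃ ten R' T'
  seq-cong : ∀ {R R' T T'} → R ≃ R' → T ≃ T' → seq R T ≃ seq R' T'
  wn-cong  : ∀ {R R'} → R ≃ R' → wn R ≃ wn R'
  oc-cong  : ∀ {R R'} → R ≃ R' → oc R ≃ oc R'
  neg-cong : ∀ {R R'} → R ≃ R' → neg R ≃ neg R'
  par-assoc : ∀ {R T U} → par (par R T) U ≃ par R (par T U)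
  ten-assoc : ∀ {R T U} → ten (ten R T) U ≃ ten R (ten T U)
  seq-assoc : ∀ {R T U} → seq (seq R T) U ≃ seq R (seq T U)
  par-comm : ∀ {R T} → par R T ≃ par T R
  ten-comm : ∀ {R T} → ten R T ≃ ten T R
  par-unit  : ∀ {R} → par unit R ≃ R
  ten-unit  : ∀ {R} → ten unit R ≃ R
  seq-unitˡ : ∀ {R} → seq unit R ≃ R
  seq-unitʳ : ∀ {R} → seq R unit ≃ R
  neg-unit : neg unit ≃ unit
  neg-at   : ∀ {a} → neg (at a) ≃ at (dual a)
  neg-par  : ∀ {R T} → neg (par R T) ≃ ten (neg R) (neg T)
  neg-ten  : ∀ {R T} → neg (ten R T) ≃ par (neg R) (neg T)
  neg-seq  : ∀ {R T} → neg (seq R T) ≃ seq (neg R) (neg T)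
  neg-wn   : ∀ {R} → neg (wn R) ≃ oc (neg R)
  neg-oc   : ∀ {R} → neg (oc R) ≃ wn (neg R)
  neg-neg  : ∀ {R} → neg (neg R) ≃ R

-- Contexts: one hole, not in the scope of a negation.

data Ctx : Set where
  hole : Ctx
  parL : Ctx → Str → Ctx
  parR : Str → Ctx → Ctx
  tenL : Ctx → Str → Ctx
  tenR : Str → Ctx → Ctx
  seqL : Ctx → Str → Ctx
  seqR : Str → Ctx → Ctx
  wnC  : Ctx → Ctx
  ocC  : Ctx → Ctx

_⟦_⟧ : Ctx → Str → Str
hole     ⟦ R ⟧ = R
parL S T ⟦ R ⟧ = par (S ⟦ R ⟧) T
parR T S ⟦ R ⟧ = par T (S ⟦ R ⟧)
tenL S T ⟦ R ⟧ = ten (S ⟦ R ⟧) T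
tenR T S ⟦ R ⟧ = ten T (S ⟦ R ⟧)
seqL S T ⟦ R ⟧ = seq (S ⟦ R ⟧) T
seqR T S ⟦ R ⟧ = seq T (S ⟦ R ⟧)
wnC S    ⟦ R ⟧ = wn (S ⟦ R ⟧)
ocC S    ⟦ R ⟧ = oc (S ⟦ R ⟧)

-- Rules of SNEL and their instances (premise, conclusion).

data Rule : Set where
  ai↓ ai↑ s q↓ q↑ p↓ p↑ e↓ e↑ w↓ w↑ b↓ b↑ g↓ g↑ : Rule

data Inst : Rule → Str → Str → Set where
  ai↓-i : ∀ S a → Inst ai↓ (S ⟦ unit ⟧) (S ⟦ par (at a) (at (dual a)) ⟧)
  ai↑-i : ∀ S a → Inst ai↑ (S ⟦ ten (at a) (at (dual a)) ⟧) (S ⟦ unit ⟧)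
  s-i   : ∀ S R T U → Inst s (S ⟦ ten (par R U) T ⟧) (S ⟦ par (ten R T) U ⟧)
  q↓-i  : ∀ S R T U V →
          Inst q↓ (S ⟦ seq (par R U) (par T V) ⟧) (S ⟦ par (seq R T) (seq U V) ⟧)
  q↑-i  : ∀ S R T U V →
          Inst q↑ (S ⟦ ten (seq R U) (seq T V) ⟧) (S ⟦ seq (ten R T) (ten U V) ⟧)
  p↓-i  : ∀ S R T → Inst p↓ (S ⟦ oc (par R T) ⟧) (S ⟦ par (oc R) (wn T) ⟧)
  p↑-i  : ∀ S R T → Inst p↑ (S ⟦ ten (wn R) (oc T) ⟧) (S ⟦ wn (ten R T) ⟧)
  e↓-i  : ∀ S → Inst e↓ (S ⟦ unit ⟧) (S ⟦ oc unit ⟧)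
  e↑-i  : ∀ S → Inst e↑ (S ⟦ wn unit ⟧) (S ⟦ unit ⟧)
  w↓-i  : ∀ S R → Inst w↓ (S ⟦ unit ⟧) (S ⟦ wn R ⟧)
  w↑-i  : ∀ S R → Inst w↑ (S ⟦ oc R ⟧) (S ⟦ unit ⟧)
  b↓-i  : ∀ S R → Inst b↓ (S ⟦ par (wn R) R ⟧) (S ⟦ wn R ⟧)
  b↑-i  : ∀ S R → Inst b↑ (S ⟦ oc R ⟧) (S ⟦ ten (oc R) R ⟧)
  g↓-i  : ∀ S R → Inst g↓ (S ⟦ wn (wn R) ⟧) (S ⟦ wn R ⟧)
  g↑-i  : ∀ S R → Inst g↑ (S ⟦ oc R ⟧) (S ⟦ oc (oc R) ⟧)

RuleSet : Set₁
RuleSet = Rule → Set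

⟪_⟫ : Rule → RuleSet
⟪ r ⟫ r' = r' ≡ r

SNEL : RuleSet
SNEL _ = ⊤

data SNELh : RuleSet where
  h-s  : SNELh s
  h-q↓ : SNELh q↓
  h-q↑ : SNELh q↑
  h-p↓ : SNELh p↓
  h-p↑ : SNELh p↑

data Der (X : RuleSet) : Str → Str → Set where
  single : ∀ {T R} → T ≃ R → Der X T R
  step   : ∀ {T A B R} (r : Rule) → X r → T ≃ A → Inst r A B →
           Der X B R → Der X T R

Chain : List RuleSet → Str → Str → Set
Chain []       T R = T ≡ R
Chain (X ∷ Xs) T R = Σ Str (λ P → Der X T P × Chain Xs P R)

shape1 shape2 shape3 shape4 : List RuleSet
shape1 = ⟪ e↓ ⟫ ∷ ⟪ g↑ ⟫ ∷ ⟪ b↑ ⟫ ∷ ⟪ ai↓ ⟫ ∷ ⟪ w↓ ⟫ ∷ SNELh ∷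
         ⟪ w↑ ⟫ ∷ ⟪ ai↑ ⟫ ∷ ⟪ b↓ ⟫ ∷ ⟪ g↓ ⟫ ∷ ⟪ e↑ ⟫ ∷ []
shape2 = ⟪ g↑ ⟫ ∷ ⟪ b↑ ⟫ ∷ ⟪ e↓ ⟫ ∷ ⟪ w↓ ⟫ ∷ ⟪ ai↓ ⟫ ∷ SNELh ∷
         ⟪ ai↑ ⟫ ∷ ⟪ w↑ ⟫ ∷ ⟪ e↑ ⟫ ∷ ⟪ b↓ ⟫ ∷ ⟪ g↓ ⟫ ∷ []
shape3 = ⟪ e↓ ⟫ ∷ ⟪ g↑ ⟫ ∷ ⟪ b↑ ⟫ ∷ ⟪ w↑ ⟫ ∷ ⟪ ai↓ ⟫ ∷ SNELh ∷
         ⟪ ai↑ ⟫ ∷ ⟪ w↓ ⟫ ∷ ⟪ b↓ ⟫ ∷ ⟪ g↓ ⟫ ∷ ⟪ e↑ ⟫ ∷ []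
shape4 = ⟪ g↑ ⟫ ∷ ⟪ b↑ ⟫ ∷ ⟪ w↑ ⟫ ∷ ⟪ e↓ ⟫ ∷ ⟪ ai↓ ⟫ ∷ SNELh ∷
         ⟪ ai↑ ⟫ ∷ ⟪ e↑ ⟫ ∷ ⟪ w↓ ⟫ ∷ ⟪ b↓ ⟫ ∷ ⟪ g↓ ⟫ ∷ []

{-# OPTIONS --safe #-}
module Submission where

-- No rule is permuted through a derivation that contains both up and down
-- rules, so the usual acyclicity and termination arguments are not needed.
-- A derivation from T to R is first turned into a cut-free proof of [T̄, R]:
-- phase semantics à la Okada, in a Chu construction that also interprets the
-- self-dual seq, gives cut elimination directly.  In a cut-free proof w↓, b↓
-- and g↓ move to the bottom, where they act separately on T̄ and on R and so
-- split into a part that dualises to w↑, b↑, g↑ following T and a part ending in R;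
-- e↓, ai↓ (and w↓, when wanted) move to the top.  If the linear proof that
-- remains proves [T̄′, R′], then T′ = (T′, ∘) leads to (T′, [T̄′, R′]), by
-- switch to [(T′, T̄′), R′], and by the dual of the identity on T′ to R′.

open import Defs
open import Data.Bool.Properties using (not-involutive)
open import Data.Empty using (⊥)
open import Data.List using (List; []; _∷_; _++_; map)
open import Data.Nat using (ℕ; zero; suc; _+_; _≤_; s≤s)
open import Data.Nat.Properties using (≤-refl; ≤-trans; m≤m+n; m≤n+m; n≤1+n; m≤n⇒m≤1+n)
open import Data.Product using (∃-syntax; _×_; _,_; proj₁; proj₂; swap)
open import Data.Unit using (⊤; tt)
open import Function using (_∘_)
open import Relation.Binary.PropositionalEquality using (_≡_; refl; cong; cong₂; subst; subst₂)

infixr 7 _⅋_ _⊗_ _⊲_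
infixr 8 ¿_ ¡_ ∼_

-- Structures in negation normal form

data Form : Set where
  lit : Atom → Form
  𝟙   : Form
  _⅋_ _⊗_ _⊲_ : Form → Form → Form
  ¿_ ¡_ : Form → Form

private variable
  A A′ B B′ C C′ D U V Z : Form
  X Y : RuleSet

∼_ : Form → Form
∼ lit a   = lit (dual a)
∼ 𝟙       = 𝟙
∼ (A ⅋ B) = ∼ A ⊗ ∼ B
∼ (A ⊗ B) = ∼ A ⅋ ∼ B
∼ (A ⊲ B) = ∼ A ⊲ ∼ B
∼ ¿ A     = ¡ ∼ A
∼ ¡ A     = ¿ ∼ A

dual-involutive : ∀ a → dual (dual a) ≡ a
dual-involutive (n , b) = cong (n ,_) (not-involutive b)

∼-involutive : ∀ A → ∼ ∼ A ≡ A
∼-involutive (lit a) = cong lit (dual-involutive a)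
∼-involutive 𝟙       = refl
∼-involutive (A ⅋ B) = cong₂ _⅋_ (∼-involutive A) (∼-involutive B)
∼-involutive (A ⊗ B) = cong₂ _⊗_ (∼-involutive A) (∼-involutive B)
∼-involutive (A ⊲ B) = cong₂ _⊲_ (∼-involutive A) (∼-involutive B)
∼-involutive (¿ A)   = cong ¿_ (∼-involutive A)
∼-involutive (¡ A)   = cong ¡_ (∼-involutive A)

data Ax : Form → Form → Set where
  ⅋-assoc : Ax ((A ⅋ B) ⅋ C) (A ⅋ (B ⅋ C))
  ⊗-assoc : Ax ((A ⊗ B) ⊗ C) (A ⊗ (B ⊗ C))
  ⊲-assoc : Ax ((A ⊲ B) ⊲ C) (A ⊲ (B ⊲ C))
  ⅋-comm  : Ax (A ⅋ B) (B ⅋ A)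
  ⊗-comm  : Ax (A ⊗ B) (B ⊗ A)
  ⅋-unit  : Ax (𝟙 ⅋ A) A
  ⊗-unit  : Ax (𝟙 ⊗ A) A
  ⊲-unitˡ : Ax (𝟙 ⊲ A) A
  ⊲-unitʳ : Ax (A ⊲ 𝟙) A

data Redex : Rule → Form → Form → Set where
  ai↓ : ∀ a → Redex ai↓ 𝟙 (lit a ⅋ lit (dual a))
  ai↑ : ∀ a → Redex ai↑ (lit a ⊗ lit (dual a)) 𝟙
  s   : Redex s ((A ⅋ C) ⊗ B) ((A ⊗ B) ⅋ C)
  q↓  : Redex q↓ ((A ⅋ C) ⊲ (B ⅋ D)) ((A ⊲ B) ⅋ (C ⊲ D))
  q↑  : Redex q↑ ((A ⊲ C) ⊗ (B ⊲ D)) ((A ⊗ B) ⊲ (C ⊗ D))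
  p↓  : Redex p↓ (¡ (A ⅋ B)) (¡ A ⅋ ¿ B)
  p↑  : Redex p↑ (¿ A ⊗ ¡ B) (¿ (A ⊗ B))
  e↓  : Redex e↓ 𝟙 (¡ 𝟙)
  e↑  : Redex e↑ (¿ 𝟙) 𝟙
  w↓  : Redex w↓ 𝟙 (¿ A)
  w↑  : Redex w↑ (¡ A) 𝟙
  b↓  : Redex b↓ (¿ A ⅋ A) (¿ A)
  b↑  : Redex b↑ (¡ A) (¡ A ⊗ A)
  g↓  : Redex g↓ (¿ ¿ A) (¿ A)
  g↑  : Redex g↑ (¡ A) (¡ ¡ A)

infix  4 _⊢_⟶_
infixr 5 _⨟_
infixr 7 _⅋ᶜ_ _⊗ᶜ_ _⊲ᶜ_

-- Closure under contexts is expressed by parallel congruences instead of one-hole contexts, so that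
-- inductions follow the connectives. Equations are available for every `X`; over `∅`, derivability
-- is the congruence itself.
data _⊢_⟶_ (X : RuleSet) : Form → Form → Set where
  ε    : X ⊢ A ⟶ A
  _⨟_  : X ⊢ A ⟶ B → X ⊢ B ⟶ C → X ⊢ A ⟶ C
  ax   : Ax A B → X ⊢ A ⟶ B
  ax⁻  : Ax A B → X ⊢ B ⟶ A
  rule : ∀ {r} → X r → Redex r A B → X ⊢ A ⟶ B
  _⅋ᶜ_ : X ⊢ A ⟶ A′ → X ⊢ B ⟶ B′ → X ⊢ A ⅋ B ⟶ A′ ⅋ B′
  _⊗ᶜ_ : X ⊢ A ⟶ A′ → X ⊢ B ⟶ B′ → X ⊢ A ⊗ B ⟶ A′ ⊗ B′
  _⊲ᶜ_ : X ⊢ A ⟶ A′ → X ⊢ B ⟶ B′ → X ⊢ A ⊲ B ⟶ A′ ⊲ B′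
  ¿ᶜ   : X ⊢ A ⟶ A′ → X ⊢ ¿ A ⟶ ¿ A′
  ¡ᶜ   : X ⊢ A ⟶ A′ → X ⊢ ¡ A ⟶ ¡ A′

∅ : RuleSet
∅ _ = ⊥

⊢-mono : (∀ {r} → X r → Y r) → X ⊢ A ⟶ B → Y ⊢ A ⟶ B
⊢-mono f ε          = ε
⊢-mono f (d ⨟ e)    = ⊢-mono f d ⨟ ⊢-mono f e
⊢-mono f (ax p)     = ax p
⊢-mono f (ax⁻ p)    = ax⁻ p
⊢-mono f (rule x p) = rule (f x) p
⊢-mono f (d ⅋ᶜ e)   = ⊢-mono f d ⅋ᶜ ⊢-mono f e
⊢-mono f (d ⊗ᶜ e)   = ⊢-mono f d ⊗ᶜ ⊢-mono f e
⊢-mono f (d ⊲ᶜ e)   = ⊢-mono f d ⊲ᶜ ⊢-mono f e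
⊢-mono f (¿ᶜ d)     = ¿ᶜ (⊢-mono f d)
⊢-mono f (¡ᶜ d)     = ¡ᶜ (⊢-mono f d)

from-∅ : ∅ ⊢ A ⟶ B → X ⊢ A ⟶ B
from-∅ = ⊢-mono λ ()

⅋-unitʳ : X ⊢ A ⅋ 𝟙 ⟶ A
⅋-unitʳ = ax ⅋-comm ⨟ ax ⅋-unit

⅋-unitʳ⁻ : X ⊢ A ⟶ A ⅋ 𝟙
⅋-unitʳ⁻ = ax⁻ ⅋-unit ⨟ ax ⅋-comm

⊗-unitʳ : X ⊢ A ⊗ 𝟙 ⟶ A
⊗-unitʳ = ax ⊗-comm ⨟ ax ⊗-unit

⊗-unitʳ⁻ : X ⊢ A ⟶ A ⊗ 𝟙
⊗-unitʳ⁻ = ax⁻ ⊗-unit ⨟ ax ⊗-comm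

⅋-exchange : X ⊢ A ⅋ (B ⅋ C) ⟶ B ⅋ (A ⅋ C)
⅋-exchange = ax⁻ ⅋-assoc ⨟ ax ⅋-comm ⅋ᶜ ε ⨟ ax ⅋-assoc

⅋-rotate : X ⊢ A ⅋ (B ⅋ C) ⟶ (B ⅋ A) ⅋ C
⅋-rotate = ⅋-exchange ⨟ ax⁻ ⅋-assoc

-- Duality

dualRule : Rule → Rule
dualRule ai↓ = ai↑
dualRule ai↑ = ai↓
dualRule s   = s
dualRule q↓  = q↑
dualRule q↑  = q↓
dualRule p↓  = p↑
dualRule p↑  = p↓
dualRule e↓  = e↑
dualRule e↑  = e↓
dualRule w↓  = w↑
dualRule w↑  = w↓
dualRule b↓  = b↑
dualRule b↑  = b↓
dualRule g↓  = g↑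
dualRule g↑  = g↓

dualRedex : ∀ {r} → Redex r A B → Redex (dualRule r) (∼ B) (∼ A)
dualRedex (ai↓ a) = ai↑ (dual a)
dualRedex (ai↑ a) = ai↓ (dual a)
dualRedex s  = s
dualRedex q↓ = q↑
dualRedex q↑ = q↓
dualRedex p↓ = p↑
dualRedex p↑ = p↓
dualRedex e↓ = e↑
dualRedex e↑ = e↓
dualRedex w↓ = w↑
dualRedex w↑ = w↓
dualRedex b↓ = b↑
dualRedex b↑ = b↓
dualRedex g↓ = g↑
dualRedex g↑ = g↓

dualAx : Ax A B → X ⊢ ∼ B ⟶ ∼ A
dualAx ⅋-assoc = ax⁻ ⊗-assoc
dualAx ⊗-assoc = ax⁻ ⅋-assoc
dualAx ⊲-assoc = ax⁻ ⊲-assoc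
dualAx ⅋-comm  = ax ⊗-comm
dualAx ⊗-comm  = ax ⅋-comm
dualAx ⅋-unit  = ax⁻ ⊗-unit
dualAx ⊗-unit  = ax⁻ ⅋-unit
dualAx ⊲-unitˡ = ax⁻ ⊲-unitˡ
dualAx ⊲-unitʳ = ax⁻ ⊲-unitʳ

dualAx⁻ : Ax A B → X ⊢ ∼ A ⟶ ∼ B
dualAx⁻ ⅋-assoc = ax ⊗-assoc
dualAx⁻ ⊗-assoc = ax ⅋-assoc
dualAx⁻ ⊲-assoc = ax ⊲-assoc
dualAx⁻ ⅋-comm  = ax ⊗-comm
dualAx⁻ ⊗-comm  = ax ⅋-comm
dualAx⁻ ⅋-unit  = ax ⊗-unit
dualAx⁻ ⊗-unit  = ax ⅋-unit
dualAx⁻ ⊲-unitˡ = ax ⊲-unitˡ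
dualAx⁻ ⊲-unitʳ = ax ⊲-unitʳ

dualize : (∀ {r} → X r → Y (dualRule r)) → X ⊢ A ⟶ B → Y ⊢ ∼ B ⟶ ∼ A
dualize f ε          = ε
dualize f (d ⨟ e)    = dualize f e ⨟ dualize f d
dualize f (ax p)     = dualAx p
dualize f (ax⁻ p)    = dualAx⁻ p
dualize f (rule x p) = rule (f x) (dualRedex p)
dualize f (d ⅋ᶜ e)   = dualize f d ⊗ᶜ dualize f e
dualize f (d ⊗ᶜ e)   = dualize f d ⅋ᶜ dualize f e
dualize f (d ⊲ᶜ e)   = dualize f d ⊲ᶜ dualize f e
dualize f (¿ᶜ d)     = ¡ᶜ (dualize f d)
dualize f (¡ᶜ d)     = ¿ᶜ (dualize f d)

dual-SNELh : ∀ {r} → SNELh r → SNELh (dualRule r)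
dual-SNELh h-s  = h-s
dual-SNELh h-q↓ = h-q↑
dual-SNELh h-q↑ = h-q↓
dual-SNELh h-p↓ = h-p↑
dual-SNELh h-p↑ = h-p↓

-- Translation between structures and their normal forms

nnf : Str → Form
nnf (at a)    = lit a
nnf unit      = 𝟙
nnf (par R T) = nnf R ⅋ nnf T
nnf (ten R T) = nnf R ⊗ nnf T
nnf (seq R T) = nnf R ⊲ nnf T
nnf (wn R)    = ¿ nnf R
nnf (oc R)    = ¡ nnf R
nnf (neg R)   = ∼ nnf R

⌜_⌝ : Form → Str
⌜ lit a ⌝ = at a
⌜ 𝟙 ⌝     = unit
⌜ A ⅋ B ⌝ = par ⌜ A ⌝ ⌜ B ⌝
⌜ A ⊗ B ⌝ = ten ⌜ A ⌝ ⌜ B ⌝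
⌜ A ⊲ B ⌝ = seq ⌜ A ⌝ ⌜ B ⌝
⌜ ¿ A ⌝   = wn ⌜ A ⌝
⌜ ¡ A ⌝   = oc ⌜ A ⌝

⌜∼⌝ : ∀ A → neg ⌜ A ⌝ ≃ ⌜ ∼ A ⌝
⌜∼⌝ (lit a) = neg-at
⌜∼⌝ 𝟙       = neg-unit
⌜∼⌝ (A ⅋ B) = ≃-trans neg-par (ten-cong (⌜∼⌝ A) (⌜∼⌝ B))
⌜∼⌝ (A ⊗ B) = ≃-trans neg-ten (par-cong (⌜∼⌝ A) (⌜∼⌝ B))
⌜∼⌝ (A ⊲ B) = ≃-trans neg-seq (seq-cong (⌜∼⌝ A) (⌜∼⌝ B))
⌜∼⌝ (¿ A)   = ≃-trans neg-wn (oc-cong (⌜∼⌝ A))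
⌜∼⌝ (¡ A)   = ≃-trans neg-oc (wn-cong (⌜∼⌝ A))

⌜nnf⌝ : ∀ R → R ≃ ⌜ nnf R ⌝
⌜nnf⌝ (at a)    = ≃-refl
⌜nnf⌝ unit      = ≃-refl
⌜nnf⌝ (par R T) = par-cong (⌜nnf⌝ R) (⌜nnf⌝ T)
⌜nnf⌝ (ten R T) = ten-cong (⌜nnf⌝ R) (⌜nnf⌝ T)
⌜nnf⌝ (seq R T) = seq-cong (⌜nnf⌝ R) (⌜nnf⌝ T)
⌜nnf⌝ (wn R)    = wn-cong (⌜nnf⌝ R)
⌜nnf⌝ (oc R)    = oc-cong (⌜nnf⌝ R)
⌜nnf⌝ (neg R)   = ≃-trans (neg-cong (⌜nnf⌝ R)) (⌜∼⌝ (nnf R))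

_≈_ : Form → Form → Set
A ≈ B = (∅ ⊢ A ⟶ B) × (∅ ⊢ B ⟶ A)

≡⇒≈ : A ≡ B → A ≈ B
≡⇒≈ refl = ε , ε

-- Negation is computed by `nnf`, so the De Morgan equations hold definitionally. Both directions
-- are built together because `≃-sym` exchanges them and negation reverses them.
nnf-≃ : ∀ {R T} → R ≃ T → nnf R ≈ nnf T
nnf-≃ ≃-refl        = ε , ε
nnf-≃ (≃-sym p)     = swap (nnf-≃ p)
nnf-≃ (≃-trans p q) = proj₁ (nnf-≃ p) ⨟ proj₁ (nnf-≃ q) , proj₂ (nnf-≃ q) ⨟ proj₂ (nnf-≃ p)
nnf-≃ (par-cong p q) = proj₁ (nnf-≃ p) ⅋ᶜ proj₁ (nnf-≃ q) , proj₂ (nnf-≃ p) ⅋ᶜ proj₂ (nnf-≃ q)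
nnf-≃ (ten-cong p q) = proj₁ (nnf-≃ p) ⊗ᶜ proj₁ (nnf-≃ q) , proj₂ (nnf-≃ p) ⊗ᶜ proj₂ (nnf-≃ q)
nnf-≃ (seq-cong p q) = proj₁ (nnf-≃ p) ⊲ᶜ proj₁ (nnf-≃ q) , proj₂ (nnf-≃ p) ⊲ᶜ proj₂ (nnf-≃ q)
nnf-≃ (wn-cong p)   = ¿ᶜ (proj₁ (nnf-≃ p)) , ¿ᶜ (proj₂ (nnf-≃ p))
nnf-≃ (oc-cong p)   = ¡ᶜ (proj₁ (nnf-≃ p)) , ¡ᶜ (proj₂ (nnf-≃ p))
nnf-≃ (neg-cong p)  = dualize (λ ()) (proj₂ (nnf-≃ p)) , dualize (λ ()) (proj₁ (nnf-≃ p))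
nnf-≃ par-assoc = ax ⅋-assoc , ax⁻ ⅋-assoc
nnf-≃ ten-assoc = ax ⊗-assoc , ax⁻ ⊗-assoc
nnf-≃ seq-assoc = ax ⊲-assoc , ax⁻ ⊲-assoc
nnf-≃ par-comm  = ax ⅋-comm , ax⁻ ⅋-comm
nnf-≃ ten-comm  = ax ⊗-comm , ax⁻ ⊗-comm
nnf-≃ par-unit  = ax ⅋-unit , ax⁻ ⅋-unit
nnf-≃ ten-unit  = ax ⊗-unit , ax⁻ ⊗-unit
nnf-≃ seq-unitˡ = ax ⊲-unitˡ , ax⁻ ⊲-unitˡ
nnf-≃ seq-unitʳ = ax ⊲-unitʳ , ax⁻ ⊲-unitʳ
nnf-≃ neg-unit  = ε , ε
nnf-≃ neg-at    = ε , ε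
nnf-≃ neg-par   = ε , ε
nnf-≃ neg-ten   = ε , ε
nnf-≃ neg-seq   = ε , ε
nnf-≃ neg-wn    = ε , ε
nnf-≃ neg-oc    = ε , ε
nnf-≃ (neg-neg {R}) = ≡⇒≈ (∼-involutive (nnf R))

nnf-plug : ∀ S {R T} → X ⊢ nnf R ⟶ nnf T → X ⊢ nnf (S ⟦ R ⟧) ⟶ nnf (S ⟦ T ⟧)
nnf-plug hole       d = d
nnf-plug (parL S _) d = nnf-plug S d ⅋ᶜ ε
nnf-plug (parR _ S) d = ε ⅋ᶜ nnf-plug S d
nnf-plug (tenL S _) d = nnf-plug S d ⊗ᶜ ε
nnf-plug (tenR _ S) d = ε ⊗ᶜ nnf-plug S d
nnf-plug (seqL S _) d = nnf-plug S d ⊲ᶜ ε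
nnf-plug (seqR _ S) d = ε ⊲ᶜ nnf-plug S d
nnf-plug (wnC S)    d = ¿ᶜ (nnf-plug S d)
nnf-plug (ocC S)    d = ¡ᶜ (nnf-plug S d)

nnf-Inst : ∀ {r R T} → X r → Inst r R T → X ⊢ nnf R ⟶ nnf T
nnf-Inst x (ai↓-i S a)        = nnf-plug S (rule x (ai↓ a))
nnf-Inst x (ai↑-i S a)        = nnf-plug S (rule x (ai↑ a))
nnf-Inst x (s-i S _ _ _)      = nnf-plug S (rule x s)
nnf-Inst x (q↓-i S _ _ _ _)   = nnf-plug S (rule x q↓)
nnf-Inst x (q↑-i S _ _ _ _)   = nnf-plug S (rule x q↑)
nnf-Inst x (p↓-i S _ _)       = nnf-plug S (rule x p↓)
nnf-Inst x (p↑-i S _ _)       = nnf-plug S (rule x p↑)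
nnf-Inst x (e↓-i S)           = nnf-plug S (rule x e↓)
nnf-Inst x (e↑-i S)           = nnf-plug S (rule x e↑)
nnf-Inst x (w↓-i S _)         = nnf-plug S (rule x w↓)
nnf-Inst x (w↑-i S _)         = nnf-plug S (rule x w↑)
nnf-Inst x (b↓-i S _)         = nnf-plug S (rule x b↓)
nnf-Inst x (b↑-i S _)         = nnf-plug S (rule x b↑)
nnf-Inst x (g↓-i S _)         = nnf-plug S (rule x g↓)
nnf-Inst x (g↑-i S _)         = nnf-plug S (rule x g↑)

nnf-Der : ∀ {R T} → Der X T R → X ⊢ nnf T ⟶ nnf R
nnf-Der (single p)       = from-∅ (proj₁ (nnf-≃ p))
nnf-Der (step r x p i d) = from-∅ (proj₁ (nnf-≃ p)) ⨟ nnf-Inst x i ⨟ nnf-Der d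

_∘ᶜ_ : Ctx → Ctx → Ctx
hole     ∘ᶜ S′ = S′
parL S T ∘ᶜ S′ = parL (S ∘ᶜ S′) T
parR T S ∘ᶜ S′ = parR T (S ∘ᶜ S′)
tenL S T ∘ᶜ S′ = tenL (S ∘ᶜ S′) T
tenR T S ∘ᶜ S′ = tenR T (S ∘ᶜ S′)
seqL S T ∘ᶜ S′ = seqL (S ∘ᶜ S′) T
seqR T S ∘ᶜ S′ = seqR T (S ∘ᶜ S′)
wnC S    ∘ᶜ S′ = wnC (S ∘ᶜ S′)
ocC S    ∘ᶜ S′ = ocC (S ∘ᶜ S′)

plug-∘ᶜ : ∀ S S′ R → (S ∘ᶜ S′) ⟦ R ⟧ ≡ S ⟦ S′ ⟦ R ⟧ ⟧
plug-∘ᶜ hole       S′ R = refl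
plug-∘ᶜ (parL S T) S′ R = cong (λ P → par P T) (plug-∘ᶜ S S′ R)
plug-∘ᶜ (parR T S) S′ R = cong (par T) (plug-∘ᶜ S S′ R)
plug-∘ᶜ (tenL S T) S′ R = cong (λ P → ten P T) (plug-∘ᶜ S S′ R)
plug-∘ᶜ (tenR T S) S′ R = cong (ten T) (plug-∘ᶜ S S′ R)
plug-∘ᶜ (seqL S T) S′ R = cong (λ P → seq P T) (plug-∘ᶜ S S′ R)
plug-∘ᶜ (seqR T S) S′ R = cong (seq T) (plug-∘ᶜ S S′ R)
plug-∘ᶜ (wnC S)    S′ R = cong wn (plug-∘ᶜ S S′ R)
plug-∘ᶜ (ocC S)    S′ R = cong oc (plug-∘ᶜ S S′ R)

plug-≃ : ∀ S {R T} → R ≃ T → S ⟦ R ⟧ ≃ S ⟦ T ⟧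
plug-≃ hole       p = p
plug-≃ (parL S T) p = par-cong (plug-≃ S p) ≃-refl
plug-≃ (parR T S) p = par-cong ≃-refl (plug-≃ S p)
plug-≃ (tenL S T) p = ten-cong (plug-≃ S p) ≃-refl
plug-≃ (tenR T S) p = ten-cong ≃-refl (plug-≃ S p)
plug-≃ (seqL S T) p = seq-cong (plug-≃ S p) ≃-refl
plug-≃ (seqR T S) p = seq-cong ≃-refl (plug-≃ S p)
plug-≃ (wnC S)    p = wn-cong (plug-≃ S p)
plug-≃ (ocC S)    p = oc-cong (plug-≃ S p)

⌜Ax⌝ : Ax A B → ⌜ A ⌝ ≃ ⌜ B ⌝
⌜Ax⌝ ⅋-assoc = par-assoc
⌜Ax⌝ ⊗-assoc = ten-assoc
⌜Ax⌝ ⊲-assoc = seq-assoc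
⌜Ax⌝ ⅋-comm  = par-comm
⌜Ax⌝ ⊗-comm  = ten-comm
⌜Ax⌝ ⅋-unit  = par-unit
⌜Ax⌝ ⊗-unit  = ten-unit
⌜Ax⌝ ⊲-unitˡ = seq-unitˡ
⌜Ax⌝ ⊲-unitʳ = seq-unitʳ

⌜Redex⌝ : ∀ {r} S → Redex r A B → Inst r (S ⟦ ⌜ A ⌝ ⟧) (S ⟦ ⌜ B ⌝ ⟧)
⌜Redex⌝ S (ai↓ a) = ai↓-i S a
⌜Redex⌝ S (ai↑ a) = ai↑-i S a
⌜Redex⌝ S s  = s-i S _ _ _
⌜Redex⌝ S q↓ = q↓-i S _ _ _ _
⌜Redex⌝ S q↑ = q↑-i S _ _ _ _
⌜Redex⌝ S p↓ = p↓-i S _ _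
⌜Redex⌝ S p↑ = p↑-i S _ _
⌜Redex⌝ S e↓ = e↓-i S
⌜Redex⌝ S e↑ = e↑-i S
⌜Redex⌝ S w↓ = w↓-i S _
⌜Redex⌝ S w↑ = w↑-i S _
⌜Redex⌝ S b↓ = b↓-i S _
⌜Redex⌝ S b↑ = b↑-i S _
⌜Redex⌝ S g↓ = g↓-i S _
⌜Redex⌝ S g↑ = g↑-i S _

Der-respˡ : ∀ {R R′ T} → R ≃ R′ → Der X R′ T → Der X R T
Der-respˡ p (single q)       = single (≃-trans p q)
Der-respˡ p (step r x q i d) = step r x (≃-trans p q) i d

Der-trans : ∀ {R T P} → Der X R T → Der X T P → Der X R P
Der-trans (single p)       e = Der-respˡ p e
Der-trans (step r x p i d) e = step r x p i (Der-trans d e)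

-- The surrounding `S` is general so that each congruence can extend it by one frame; the two sides
-- of a parallel step are run one after the other.
⌜⌝-in : ∀ S → X ⊢ A ⟶ B → Der X (S ⟦ ⌜ A ⌝ ⟧) (S ⟦ ⌜ B ⌝ ⟧)

⌜⌝-under : ∀ S S′ → X ⊢ A ⟶ B → Der X (S ⟦ S′ ⟦ ⌜ A ⌝ ⟧ ⟧) (S ⟦ S′ ⟦ ⌜ B ⌝ ⟧ ⟧)
⌜⌝-under S S′ d = subst₂ (Der _) (plug-∘ᶜ S S′ _) (plug-∘ᶜ S S′ _) (⌜⌝-in (S ∘ᶜ S′) d)

⌜⌝-in S ε          = single ≃-refl
⌜⌝-in S (d ⨟ e)    = Der-trans (⌜⌝-in S d) (⌜⌝-in S e)
⌜⌝-in S (ax p)     = single (plug-≃ S (⌜Ax⌝ p))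
⌜⌝-in S (ax⁻ p)    = single (plug-≃ S (≃-sym (⌜Ax⌝ p)))
⌜⌝-in S (rule x p) = step _ x ≃-refl (⌜Redex⌝ S p) (single ≃-refl)
⌜⌝-in S (d ⅋ᶜ e)   = Der-trans (⌜⌝-under S (parL hole _) d) (⌜⌝-under S (parR _ hole) e)
⌜⌝-in S (d ⊗ᶜ e)   = Der-trans (⌜⌝-under S (tenL hole _) d) (⌜⌝-under S (tenR _ hole) e)
⌜⌝-in S (d ⊲ᶜ e)   = Der-trans (⌜⌝-under S (seqL hole _) d) (⌜⌝-under S (seqR _ hole) e)
⌜⌝-in S (¿ᶜ d)     = ⌜⌝-under S (wnC hole) d
⌜⌝-in S (¡ᶜ d)     = ⌜⌝-under S (ocC hole) d

-- Cut elimination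

data NEL : RuleSet where
  n-ai↓ : NEL ai↓
  n-s   : NEL s
  n-q↓  : NEL q↓
  n-p↓  : NEL p↓
  n-e↓  : NEL e↓
  n-w↓  : NEL w↓
  n-b↓  : NEL b↓
  n-g↓  : NEL g↓

Provable : Form → Set
Provable A = NEL ⊢ 𝟙 ⟶ A

Provable-⅋ : Provable A → Provable B → Provable (A ⅋ B)
Provable-⅋ d e = ax⁻ ⅋-unit ⨟ d ⅋ᶜ e

-- Elements of the Chu construction over sets of formulas closed under
-- cut-free derivability, with the provable formulas as dualising object.

record Chu : Set₁ where
  field
    pro con    : Form → Set
    pro-closed : NEL ⊢ A ⟶ B → pro A → pro B
    con-closed : NEL ⊢ A ⟶ B → con A → con B
    pairing    : pro A → con B → Provable (A ⅋ B)

open Chu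

infix 4 _≼_
-- A Chu morphism is contravariant on `con`, so `swap` turns `a ≼ b` into `b * ≼ a *`. As `pairing`
-- is not inspected, `*` behaves here as a strict involution.
_≼_ : Chu → Chu → Set
a ≼ b = (∀ U → pro a U → pro b U) × (∀ U → con b U → con a U)

≼-trans : ∀ a b c → a ≼ b → b ≼ c → a ≼ c
≼-trans _ _ _ (f , f′) (g , g′) = (λ U → g U ∘ f U) , (λ U → f′ U ∘ g′ U)

_* : Chu → Chu
(a *) .pro = con a
(a *) .con = pro a
(a *) .pro-closed = con-closed a
(a *) .con-closed = pro-closed a
(a *) .pairing x y = pairing a y x ⨟ ax ⅋-comm

I : Chu
I .pro = Provable
I .con = Provable
I .pro-closed d p = p ⨟ d
I .con-closed d p = p ⨟ d
I .pairing = Provable-⅋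

infixr 7 _⊠_ _⊞_ _◃_

-- The Chu tensor: Day convolution along `⅋` on `pro`, and both transposed maps on `con`, since
-- `con a` need not be the full orthogonal of `pro a`.
_⊠_ : Chu → Chu → Chu
(a ⊠ b) .pro U = ∃[ V ] ∃[ Z ] pro a V × pro b Z × NEL ⊢ V ⅋ Z ⟶ U
(a ⊠ b) .con U = (∀ V → pro a V → con b (V ⅋ U)) × (∀ V → pro b V → con a (V ⅋ U))
(a ⊠ b) .pro-closed d (V , Z , v , z , e) = V , Z , v , z , e ⨟ d
(a ⊠ b) .con-closed d (f , g) =
  (λ V v → con-closed b (ε ⅋ᶜ d) (f V v)) , (λ V v → con-closed a (ε ⅋ᶜ d) (g V v))
(a ⊠ b) .pairing (V , Z , v , z , e) (f , g) =
  pairing b z (f V v) ⨟ ⅋-rotate ⨟ e ⅋ᶜ ε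

_⊞_ : Chu → Chu → Chu
a ⊞ b = ((a *) ⊠ (b *)) *

-- The same convolution along `⊲` on both sides makes seq self-dual; `q↓` is what lets the two sides
-- pair.
_◃_ : Chu → Chu → Chu
(a ◃ b) .pro U = ∃[ V ] ∃[ Z ] pro a V × pro b Z × NEL ⊢ V ⊲ Z ⟶ U
(a ◃ b) .con U = ∃[ V ] ∃[ Z ] con a V × con b Z × NEL ⊢ V ⊲ Z ⟶ U
(a ◃ b) .pro-closed d (V , Z , v , z , e) = V , Z , v , z , e ⨟ d
(a ◃ b) .con-closed d (V , Z , v , z , e) = V , Z , v , z , e ⨟ d
(a ◃ b) .pairing (V , Z , v , z , d) (V′ , Z′ , v′ , z′ , d′) =
  ax⁻ ⊲-unitˡ ⨟ pairing a v v′ ⊲ᶜ pairing b z z′ ⨟ rule n-q↓ q↓ ⨟ d ⅋ᶜ d′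

-- The side contexts of the promotion rule.
data Whynots : Form → Set where
  none : Whynots 𝟙
  one  : Whynots (¿ A)
  _&_  : Whynots A → Whynots B → Whynots (A ⅋ B)

weaken : Whynots A → NEL ⊢ 𝟙 ⟶ A
weaken none    = ε
weaken one     = rule n-w↓ w↓
weaken (p & q) = Provable-⅋ (weaken p) (weaken q)

contract : Whynots A → NEL ⊢ A ⅋ A ⟶ A
contract none    = ax ⅋-unit
-- `b↓` merges `¿ A` only with a bare `A`. So one copy is raised to `¿ ¿ A`, absorbs the other, and
-- `g↓` removes the extra `¿`.
contract one     =
  (ax⁻ ⅋-unit ⨟ rule n-w↓ w↓ ⅋ᶜ ε ⨟ rule n-b↓ b↓) ⅋ᶜ ε ⨟ rule n-b↓ b↓ ⨟ rule n-g↓ g↓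
contract (p & q) =
  ax ⅋-assoc ⨟ ε ⅋ᶜ ⅋-exchange ⨟ ax⁻ ⅋-assoc ⨟ contract p ⅋ᶜ contract q

-- `p↓` puts a second `¿` on the side formula, and `g↓` removes it.
promote : Whynots A → NEL ⊢ ¡ (A ⅋ B) ⟶ A ⅋ ¡ B
promote none    = ¡ᶜ (ax ⅋-unit) ⨟ ax⁻ ⅋-unit
promote one     = ¡ᶜ (ax ⅋-comm) ⨟ rule n-p↓ p↓ ⨟ ax ⅋-comm ⨟ rule n-g↓ g↓ ⅋ᶜ ε
promote (p & q) = ¡ᶜ (ax ⅋-assoc) ⨟ promote p ⨟ ε ⅋ᶜ promote q ⨟ ax⁻ ⅋-assoc

-- Okada's exponential: `pro` is generated by the elements of `pro a` that are side contexts of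
-- promotion, and `con` is their full orthogonal.
bang : Chu → Chu
bang a .pro U = ∃[ V ] Whynots V × pro a V × NEL ⊢ V ⟶ U
bang a .con U = ∀ V → Whynots V → pro a V → Provable (V ⅋ U)
bang a .pro-closed d (V , w , v , e) = V , w , v , e ⨟ d
bang a .con-closed d f V w v = f V w v ⨟ ε ⅋ᶜ d
bang a .pairing (V , w , v , e) f = f V w v ⨟ e ⅋ᶜ ε

quest : Chu → Chu
quest a = bang (a *) *

literal : Atom → Chu
literal a .pro = NEL ⊢ lit (dual a) ⟶_
literal a .con = NEL ⊢ lit a ⟶_
literal a .pro-closed d e = e ⨟ d
literal a .con-closed d e = e ⨟ d
literal a .pairing d e = rule n-ai↓ (ai↓ a) ⨟ ax ⅋-comm ⨟ d ⅋ᶜ e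

-- An element `U` of `pro ⟨ A ⟩` can be read as a context proving `A`: `self-con` and `pairing`
-- yield `Provable (U ⅋ A)`. Elements of `con ⟨ A ⟩` play that role for `∼ A`.
⟨_⟩ : Form → Chu
⟨ lit x ⟩ = literal x
⟨ 𝟙 ⟩     = I
⟨ A ⅋ B ⟩ = ⟨ A ⟩ ⊞ ⟨ B ⟩
⟨ A ⊗ B ⟩ = ⟨ A ⟩ ⊠ ⟨ B ⟩
⟨ A ⊲ B ⟩ = ⟨ A ⟩ ◃ ⟨ B ⟩
⟨ ¿ A ⟩   = quest ⟨ A ⟩
⟨ ¡ A ⟩   = bang ⟨ A ⟩

-- Functoriality and structural laws of the model.

⊠-mono : ∀ a b a′ b′ → a ≼ a′ → b ≼ b′ → a ⊠ b ≼ a′ ⊠ b′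
⊠-mono _ _ _ _ (f , f′) (g , g′) =
  (λ { U (V , Z , v , z , d) → V , Z , f V v , g Z z , d }) ,
  (λ { U (h , k) → (λ V v → g′ _ (h V (f V v))) , (λ V v → f′ _ (k V (g V v))) })

⊞-mono : ∀ a b a′ b′ → a ≼ a′ → b ≼ b′ → a ⊞ b ≼ a′ ⊞ b′
⊞-mono a b a′ b′ p q = swap (⊠-mono (a′ *) (b′ *) (a *) (b *) (swap p) (swap q))

◃-mono : ∀ a b a′ b′ → a ≼ a′ → b ≼ b′ → a ◃ b ≼ a′ ◃ b′
◃-mono _ _ _ _ (f , f′) (g , g′) =
  (λ { U (V , Z , v , z , d) → V , Z , f V v , g Z z , d }) ,
  (λ { U (V , Z , v , z , d) → V , Z , f′ V v , g′ Z z , d })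

bang-mono : ∀ a b → a ≼ b → bang a ≼ bang b
bang-mono _ _ (f , f′) =
  (λ { U (V , w , v , d) → V , w , f V v , d }) , (λ U h V w v → h V w (f V v))

quest-mono : ∀ a b → a ≼ b → quest a ≼ quest b
quest-mono a b p = swap (bang-mono (b *) (a *) (swap p))

⊠-comm : ∀ a b → a ⊠ b ≼ b ⊠ a
⊠-comm _ _ = (λ { U (V , Z , v , z , d) → Z , V , z , v , ax ⅋-comm ⨟ d }) , (λ U → swap)

⊠-assoc : ∀ a b c → (a ⊠ b) ⊠ c ≼ a ⊠ (b ⊠ c)
⊠-assoc a b c =
  (λ { U (V , Z , (V₁ , V₂ , v₁ , v₂ , d) , z , e) →
       V₁ , V₂ ⅋ Z , v₁ , (V₂ , Z , v₂ , z , ε) , ax⁻ ⅋-assoc ⨟ d ⅋ᶜ ε ⨟ e }) ,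
  (λ { U (f , g) →
       (λ { V (V₁ , V₂ , v₁ , v₂ , d) →
            con-closed c (⅋-rotate ⨟ d ⅋ᶜ ε) (proj₁ (f V₁ v₁) V₂ v₂) }) ,
       (λ Z z → (λ V v → con-closed b ⅋-exchange (proj₂ (f V v) Z z)) ,
                (λ V v → con-closed a (ax ⅋-assoc) (g (V ⅋ Z) (V , Z , v , z , ε)))) })

⊠-assoc⁻ : ∀ a b c → a ⊠ (b ⊠ c) ≼ (a ⊠ b) ⊠ c
⊠-assoc⁻ a b c =
  (λ { U (V , Z , v , (Z₁ , Z₂ , z₁ , z₂ , d) , e) →
       V ⅋ Z₁ , Z₂ , (V , Z₁ , v , z₁ , ε) , z₂ , ax ⅋-assoc ⨟ ε ⅋ᶜ d ⨟ e }) ,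
  (λ { U (f , g) →
       (λ V v → (λ Z z → con-closed c (ax ⅋-comm ⅋ᶜ ε ⨟ ax ⅋-assoc) (f (V ⅋ Z) (V , Z , v , z , ε))) ,
                (λ Z z → con-closed b ⅋-exchange (proj₁ (g Z z) V v))) ,
       (λ { Z (Z₁ , Z₂ , z₁ , z₂ , d) →
            con-closed a (ax⁻ ⅋-assoc ⨟ d ⅋ᶜ ε) (proj₂ (g Z₂ z₂) Z₁ z₁) }) })

⊠-unit : ∀ a → I ⊠ a ≼ a
⊠-unit a =
  (λ { U (V , Z , v , z , d) → pro-closed a (ax⁻ ⅋-unit ⨟ v ⅋ᶜ ε ⨟ d) z }) ,
  (λ U u → (λ V v → con-closed a (ax⁻ ⅋-unit ⨟ v ⅋ᶜ ε) u) , (λ V v → pairing a v u))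

⊠-unit⁻ : ∀ a → a ≼ I ⊠ a
⊠-unit⁻ a =
  (λ U u → 𝟙 , U , ε , u , ax ⅋-unit) ,
  (λ { U (f , g) → con-closed a (ax ⅋-unit) (f 𝟙 ε) })

◃-assoc : ∀ a b c → (a ◃ b) ◃ c ≼ a ◃ (b ◃ c)
◃-assoc _ _ _ =
  (λ { U (V , Z , (V₁ , V₂ , v₁ , v₂ , d) , z , e) →
       V₁ , V₂ ⊲ Z , v₁ , (V₂ , Z , v₂ , z , ε) , ax⁻ ⊲-assoc ⨟ d ⊲ᶜ ε ⨟ e }) ,
  (λ { U (V , Z , v , (Z₁ , Z₂ , z₁ , z₂ , d) , e) →
       V ⊲ Z₁ , Z₂ , (V , Z₁ , v , z₁ , ε) , z₂ , ax ⊲-assoc ⨟ ε ⊲ᶜ d ⨟ e })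

◃-unitˡ : ∀ a → I ◃ a ≼ a
◃-unitˡ a =
  (λ { U (V , Z , v , z , d) → pro-closed a (ax⁻ ⊲-unitˡ ⨟ v ⊲ᶜ ε ⨟ d) z }) ,
  (λ U u → 𝟙 , U , ε , u , ax ⊲-unitˡ)

◃-unitʳ : ∀ a → a ◃ I ≼ a
◃-unitʳ a =
  (λ { U (V , Z , v , z , d) → pro-closed a (ax⁻ ⊲-unitʳ ⨟ ε ⊲ᶜ z ⨟ d) v }) ,
  (λ U u → U , 𝟙 , u , ε , ax ⊲-unitʳ)

I≼⊞ : ∀ a → I ≼ a ⊞ (a *)
I≼⊞ a =
  (λ U u → (λ V v → con-closed a (⅋-unitʳ⁻ ⨟ ε ⅋ᶜ u) v) , (λ V v → pro-closed a (⅋-unitʳ⁻ ⨟ ε ⅋ᶜ u) v)) ,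
  (λ { U (V , Z , v , z , d) → pairing (a *) v z ⨟ d })

-- Reassociating contexts suffices. Switch is self-dual, so this half, taken at dual objects, also
-- supplies the `con` half.
switch-pro : ∀ a b c U → pro ((a ⊞ c) ⊠ b) U → pro ((a ⊠ b) ⊞ c) U
switch-pro a b c U (V , Z , (f , g) , z , d) =
  (λ { W (h , k) → pro-closed c (ax ⅋-comm ⅋ᶜ ε ⨟ ax ⅋-assoc ⨟ ε ⅋ᶜ (ax ⅋-comm ⨟ d)) (f (Z ⅋ W) (k Z z)) }) ,
  (λ W w → W ⅋ V , Z , g W w , z , ax ⅋-assoc ⨟ ε ⅋ᶜ d)

switch : ∀ a b c → (a ⊞ c) ⊠ b ≼ (a ⊠ b) ⊞ c
switch a b c = switch-pro a b c , switch-pro (a *) (c *) (b *)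

⊞-◃-pro : ∀ a b c d U → pro ((a ⊞ c) ◃ (b ⊞ d)) U → pro ((a ◃ b) ⊞ (c ◃ d)) U
⊞-◃-pro a b c d U (V , Z , (f , f′) , (g , g′) , e) =
  (λ { W (W₁ , W₂ , w₁ , w₂ , h) →
       W₁ ⅋ V , W₂ ⅋ Z , f W₁ w₁ , g W₂ w₂ , rule n-q↓ q↓ ⨟ h ⅋ᶜ e }) ,
  (λ { W (W₁ , W₂ , w₁ , w₂ , h) →
       W₁ ⅋ V , W₂ ⅋ Z , f′ W₁ w₁ , g′ W₂ w₂ , rule n-q↓ q↓ ⨟ h ⅋ᶜ e })

⊞-◃ : ∀ a b c d → (a ⊞ c) ◃ (b ⊞ d) ≼ (a ◃ b) ⊞ (c ◃ d)
⊞-◃ a b c d =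
  ⊞-◃-pro a b c d ,
  (λ { U (V , Z , (V₁ , V₂ , v₁ , v₂ , e) , (Z₁ , Z₂ , z₁ , z₂ , h) , k) →
       V₁ ⅋ Z₁ , V₂ ⅋ Z₂ , (V₁ , Z₁ , v₁ , z₁ , ε) , (V₂ , Z₂ , v₂ , z₂ , ε) ,
       rule n-q↓ q↓ ⨟ e ⅋ᶜ h ⨟ k })

-- Side contexts are closed under `⅋`, so the one promoted for `a ⊞ b` and the one supplied against
-- `b` merge into one fit for promoting `a`.
bang-⊞ : ∀ a b → bang (a ⊞ b) ≼ bang a ⊞ quest b
bang-⊞ a b =
  (λ { U (C , w , (f , g) , d) →
       (λ V v D w′ x → v (D ⅋ C) (w′ & w) (g D x) ⨟ ax ⅋-assoc ⨟ ε ⅋ᶜ (ax ⅋-comm ⨟ ε ⅋ᶜ d)) ,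
       (λ { V (D , w′ , x , e) → D ⅋ C , w′ & w , g D x , e ⅋ᶜ d }) }) ,
  (λ { U (V , Z , v , (D , w′ , x , e) , h) C w (f , g) →
       v (D ⅋ C) (w′ & w) (g D x) ⨟ ax ⅋-comm ⅋ᶜ ε ⨟ ax ⅋-assoc ⨟ ε ⅋ᶜ (ax ⅋-comm ⨟ ε ⅋ᶜ e ⨟ h) })

I≼bang-I : I ≼ bang I
I≼bang-I = (λ U u → 𝟙 , none , ε , u) , (λ U f → f 𝟙 none ε ⨟ ax ⅋-unit)

bang-discard : ∀ a → bang a ≼ I
bang-discard a =
  (λ { U (V , w , v , d) → weaken w ⨟ d }) , (λ U u V w v → Provable-⅋ (weaken w) u)

bang-unfold : ∀ a → bang a ≼ bang a ⊠ a
bang-unfold a =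
  (λ { U (V , w , v , d) → V , V , (V , w , v , ε) , v , contract w ⨟ d }) ,
  (λ { U (f , g) V w v →
       pairing a v (f V (V , w , v , ε)) ⨟ ax⁻ ⅋-assoc ⨟ contract w ⅋ᶜ ε })

bang-dig : ∀ a → bang a ≼ bang (bang a)
bang-dig a =
  (λ { U (V , w , v , d) → V , w , (V , w , v , ε) , d }) ,
  (λ U f V w v → f V w (V , w , v , ε))

-- Soundness of the model.

sound-Ax : Ax A B → (⟨ A ⟩ ≼ ⟨ B ⟩) × (⟨ B ⟩ ≼ ⟨ A ⟩)
sound-Ax (⅋-assoc {A} {B} {C}) =
  swap (⊠-assoc⁻ (⟨ A ⟩ *) (⟨ B ⟩ *) (⟨ C ⟩ *)) , swap (⊠-assoc (⟨ A ⟩ *) (⟨ B ⟩ *) (⟨ C ⟩ *))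
sound-Ax (⊗-assoc {A} {B} {C}) = ⊠-assoc ⟨ A ⟩ ⟨ B ⟩ ⟨ C ⟩ , ⊠-assoc⁻ ⟨ A ⟩ ⟨ B ⟩ ⟨ C ⟩
sound-Ax (⊲-assoc {A} {B} {C}) =
  ◃-assoc ⟨ A ⟩ ⟨ B ⟩ ⟨ C ⟩ , swap (◃-assoc (⟨ A ⟩ *) (⟨ B ⟩ *) (⟨ C ⟩ *))
sound-Ax (⅋-comm {A} {B}) =
  swap (⊠-comm (⟨ B ⟩ *) (⟨ A ⟩ *)) , swap (⊠-comm (⟨ A ⟩ *) (⟨ B ⟩ *))
sound-Ax (⊗-comm {A} {B}) = ⊠-comm ⟨ A ⟩ ⟨ B ⟩ , ⊠-comm ⟨ B ⟩ ⟨ A ⟩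
sound-Ax (⅋-unit {A})  = swap (⊠-unit⁻ (⟨ A ⟩ *)) , swap (⊠-unit (⟨ A ⟩ *))
sound-Ax (⊗-unit {A})  = ⊠-unit ⟨ A ⟩ , ⊠-unit⁻ ⟨ A ⟩
sound-Ax (⊲-unitˡ {A}) = ◃-unitˡ ⟨ A ⟩ , swap (◃-unitˡ (⟨ A ⟩ *))
sound-Ax (⊲-unitʳ {A}) = ◃-unitʳ ⟨ A ⟩ , swap (◃-unitʳ (⟨ A ⟩ *))

literal-dual : ∀ x → (literal x * ≼ literal (dual x)) × (literal (dual x) ≼ literal x *)
literal-dual x rewrite dual-involutive x = ((λ U u → u) , (λ U u → u)) , ((λ U u → u) , (λ U u → u))

sound-Redex : ∀ {r} → Redex r A B → ⟨ A ⟩ ≼ ⟨ B ⟩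
sound-Redex (ai↓ x) =
  ≼-trans I (literal x ⊞ (literal x *)) (literal x ⊞ literal (dual x)) (I≼⊞ (literal x))
    (⊞-mono (literal x) (literal x *) (literal x) (literal (dual x))
      ((λ U u → u) , (λ U u → u)) (proj₁ (literal-dual x)))
sound-Redex (ai↑ x) =
  ≼-trans (literal x ⊠ literal (dual x)) (literal x ⊠ (literal x *)) I
    (⊠-mono (literal x) (literal (dual x)) (literal x) (literal x *)
      ((λ U u → u) , (λ U u → u)) (proj₂ (literal-dual x)))
    (swap (I≼⊞ (literal x *)))
sound-Redex (s {A} {C} {B})      = switch ⟨ A ⟩ ⟨ B ⟩ ⟨ C ⟩
sound-Redex (q↓ {A} {C} {B} {D}) = ⊞-◃ ⟨ A ⟩ ⟨ B ⟩ ⟨ C ⟩ ⟨ D ⟩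
sound-Redex (q↑ {A} {C} {B} {D}) = swap (⊞-◃ (⟨ A ⟩ *) (⟨ C ⟩ *) (⟨ B ⟩ *) (⟨ D ⟩ *))
sound-Redex (p↓ {A} {B})         = bang-⊞ ⟨ A ⟩ ⟨ B ⟩
sound-Redex (p↑ {A} {B})         = swap (bang-⊞ (⟨ A ⟩ *) (⟨ B ⟩ *))
sound-Redex e↓       = I≼bang-I
sound-Redex e↑       = swap I≼bang-I
sound-Redex (w↓ {A}) = swap (bang-discard (⟨ A ⟩ *))
sound-Redex (w↑ {A}) = bang-discard ⟨ A ⟩
sound-Redex (b↓ {A}) = swap (bang-unfold (⟨ A ⟩ *))
sound-Redex (b↑ {A}) = bang-unfold ⟨ A ⟩
sound-Redex (g↓ {A}) = swap (bang-dig (⟨ A ⟩ *))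
sound-Redex (g↑ {A}) = bang-dig ⟨ A ⟩

-- All rules of SNEL are interpreted, dual rules by the two readings of one inequality, although
-- `Chu` refers only to cut-free provability. Hence `X` is arbitrary.
sound : X ⊢ A ⟶ B → ⟨ A ⟩ ≼ ⟨ B ⟩
sound ε = (λ U u → u) , (λ U u → u)
sound (_⨟_ {A} {B} {C} d e) = ≼-trans ⟨ A ⟩ ⟨ B ⟩ ⟨ C ⟩ (sound d) (sound e)
sound (ax p)     = proj₁ (sound-Ax p)
sound (ax⁻ p)    = proj₂ (sound-Ax p)
sound (rule x p) = sound-Redex p
sound (_⅋ᶜ_ {A} {A′} {B} {B′} d e) = ⊞-mono ⟨ A ⟩ ⟨ B ⟩ ⟨ A′ ⟩ ⟨ B′ ⟩ (sound d) (sound e)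
sound (_⊗ᶜ_ {A} {A′} {B} {B′} d e) = ⊠-mono ⟨ A ⟩ ⟨ B ⟩ ⟨ A′ ⟩ ⟨ B′ ⟩ (sound d) (sound e)
sound (_⊲ᶜ_ {A} {A′} {B} {B′} d e) = ◃-mono ⟨ A ⟩ ⟨ B ⟩ ⟨ A′ ⟩ ⟨ B′ ⟩ (sound d) (sound e)
sound (¿ᶜ {A} {A′} d) = quest-mono ⟨ A ⟩ ⟨ A′ ⟩ (sound d)
sound (¡ᶜ {A} {A′} d) = bang-mono ⟨ A ⟩ ⟨ A′ ⟩ (sound d)

-- From the model back to cut-free proofs.

⊠-con : ∀ a b → con a A → con b B → con (a ⊠ b) (A ⊗ B)
⊠-con a b p q =
  (λ V v → con-closed b (ax⁻ ⊗-unit ⨟ (pairing a v p ⨟ ax ⅋-comm) ⊗ᶜ ε ⨟ rule n-s s ⨟ ax ⅋-comm) q) ,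
  (λ V v → con-closed a
    (ax⁻ ⊗-unit ⨟ (pairing b v q ⨟ ax ⅋-comm) ⊗ᶜ ε ⨟ rule n-s s ⨟ ax ⅋-comm ⨟ ε ⅋ᶜ ax ⊗-comm) p)

bang-con : ∀ a → con a A → con (bang a) (¡ A)
bang-con a p V w v = rule n-e↓ e↓ ⨟ ¡ᶜ (pairing a v p) ⨟ promote w

-- The witness is `¿ A` itself, which lies in `con a` by dereliction: `w↓` followed by `b↓`.
quest-con : ∀ a → con a A → con (quest a) (¿ A)
quest-con a p = _ , one , con-closed a (ax⁻ ⅋-unit ⨟ rule n-w↓ w↓ ⅋ᶜ ε ⨟ rule n-b↓ b↓) p , ε

-- Okada's lemma: membership of each formula in its own interpretation turns semantic statements
-- back into cut-free proofs.
self-con : ∀ A → con ⟨ A ⟩ A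
self-pro : ∀ A → pro ⟨ A ⟩ (∼ A)

self-con (lit x) = ε
self-con 𝟙       = ε
self-con (A ⅋ B) = A , B , self-con A , self-con B , ε
self-con (A ⊗ B) = ⊠-con ⟨ A ⟩ ⟨ B ⟩ (self-con A) (self-con B)
self-con (A ⊲ B) = A , B , self-con A , self-con B , ε
self-con (¿ A)   = quest-con ⟨ A ⟩ (self-con A)
self-con (¡ A)   = bang-con ⟨ A ⟩ (self-con A)

self-pro (lit x) = ε
self-pro 𝟙       = ε
self-pro (A ⅋ B) = ⊠-con (⟨ A ⟩ *) (⟨ B ⟩ *) (self-pro A) (self-pro B)
self-pro (A ⊗ B) = ∼ A , ∼ B , self-pro A , self-pro B , ε
self-pro (A ⊲ B) = ∼ A , ∼ B , self-pro A , self-pro B , ε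
self-pro (¿ A)   = bang-con (⟨ A ⟩ *) (self-pro A)
self-pro (¡ A)   = quest-con (⟨ A ⟩ *) (self-pro A)

-- The backward half of soundness carries `B` from `con ⟨ B ⟩` to `con ⟨ A ⟩`, where it pairs with
-- `∼ A`.
cut-elimination : X ⊢ A ⟶ B → Provable (∼ A ⅋ B)
cut-elimination {A = A} {B = B} d =
  pairing ⟨ A ⟩ (self-pro A) (proj₂ (sound d) B (self-con B))

-- Contractions

-- `W` is `⊥` when weakenings are kept below, and `⊤` when they are lifted with the other creations.
data Lin (W : Set) : RuleSet where
  l-ai↓ : Lin W ai↓
  l-s   : Lin W s
  l-q↓  : Lin W q↓
  l-p↓  : Lin W p↓
  l-e↓  : Lin W e↓
  l-w↓  : W → Lin W w↓

-- Parallel application of w↓, b↓ and g↓, whose redexes are absorbed into the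
-- structural rules of ¿.  If A ↠ B and B is not headed by ¿, then A has the
-- head of B, so permuting ↠ below the other rules is a matter of inversion.

infix 4 _↠_ _↠?_

data _↠_  : Form → Form → Set
data _↠?_ : Form → Form → Set

data _↠_ where
  lit  : ∀ {x} → lit x ↠ lit x
  𝟙    : 𝟙 ↠ 𝟙
  _⅋_  : A ↠ A′ → B ↠ B′ → A ⅋ B ↠ A′ ⅋ B′
  _⊗_  : A ↠ A′ → B ↠ B′ → A ⊗ B ↠ A′ ⊗ B′
  _⊲_  : A ↠ A′ → B ↠ B′ → A ⊲ B ↠ A′ ⊲ B′
  ¡_   : A ↠ A′ → ¡ A ↠ ¡ A′
  why  : A ↠? B → A ↠ ¿ B

data _↠?_ where
  nil : 𝟙 ↠? B
  der : A ↠ B → A ↠? B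
  join : A ↠? B → A′ ↠? B → A ⅋ A′ ↠? B
  dig : A ↠? B → ¿ A ↠? B

↠-dig : A ↠? ¿ B → A ↠? B
↠-dig nil           = nil
↠-dig (der (why c)) = c
↠-dig (join c c′)    = join (↠-dig c) (↠-dig c′)
↠-dig (dig c)       = dig (↠-dig c)

Linear⨾↠ : Form → Form → Set
Linear⨾↠ A B = ∃[ A′ ] Lin ⊥ ⊢ A ⟶ A′ × A′ ↠ B

permute-Ax : Ax A B → C ↠ A → Linear⨾↠ C B
permute-Ax ⅋-assoc ((c ⅋ c′) ⅋ c″) = _ , ax ⅋-assoc , c ⅋ (c′ ⅋ c″)
permute-Ax ⊗-assoc ((c ⊗ c′) ⊗ c″) = _ , ax ⊗-assoc , c ⊗ (c′ ⊗ c″)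
permute-Ax ⊲-assoc ((c ⊲ c′) ⊲ c″) = _ , ax ⊲-assoc , c ⊲ (c′ ⊲ c″)
permute-Ax ⅋-comm  (c ⅋ c′) = _ , ax ⅋-comm , c′ ⅋ c
permute-Ax ⊗-comm  (c ⊗ c′) = _ , ax ⊗-comm , c′ ⊗ c
permute-Ax ⅋-unit  (𝟙 ⅋ c)  = _ , ax ⅋-unit , c
permute-Ax ⊗-unit  (𝟙 ⊗ c)  = _ , ax ⊗-unit , c
permute-Ax ⊲-unitˡ (𝟙 ⊲ c)  = _ , ax ⊲-unitˡ , c
permute-Ax ⊲-unitʳ (c ⊲ 𝟙)  = _ , ax ⊲-unitʳ , c

permute-Ax⁻ : Ax B A → C ↠ A → Linear⨾↠ C B
permute-Ax⁻ ⅋-assoc (c ⅋ (c′ ⅋ c″)) = _ , ax⁻ ⅋-assoc , (c ⅋ c′) ⅋ c″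
permute-Ax⁻ ⊗-assoc (c ⊗ (c′ ⊗ c″)) = _ , ax⁻ ⊗-assoc , (c ⊗ c′) ⊗ c″
permute-Ax⁻ ⊲-assoc (c ⊲ (c′ ⊲ c″)) = _ , ax⁻ ⊲-assoc , (c ⊲ c′) ⊲ c″
permute-Ax⁻ ⅋-comm  (c ⅋ c′) = _ , ax ⅋-comm , c′ ⅋ c
permute-Ax⁻ ⊗-comm  (c ⊗ c′) = _ , ax ⊗-comm , c′ ⊗ c
permute-Ax⁻ ⅋-unit  c = _ , ax⁻ ⅋-unit , 𝟙 ⅋ c
permute-Ax⁻ ⊗-unit  c = _ , ax⁻ ⊗-unit , 𝟙 ⊗ c
permute-Ax⁻ ⊲-unitˡ c = _ , ax⁻ ⊲-unitˡ , 𝟙 ⊲ c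
permute-Ax⁻ ⊲-unitʳ c = _ , ax⁻ ⊲-unitʳ , c ⊲ 𝟙

permute-Redex : ∀ {r} → NEL r → Redex r A B → C ↠ A → Linear⨾↠ C B
permute-Redex n-ai↓ (ai↓ x) 𝟙 = _ , rule l-ai↓ (ai↓ x) , lit ⅋ lit
permute-Redex n-s  s  ((c ⅋ c′) ⊗ c″) = _ , rule l-s s , (c ⊗ c″) ⅋ c′
permute-Redex n-q↓ q↓ ((c ⅋ c′) ⊲ (k ⅋ k′)) = _ , rule l-q↓ q↓ , (c ⊲ k) ⅋ (c′ ⊲ k′)
-- `_↠_` has no congruence for `¿`; `dig` over `der` has its effect.
permute-Redex n-p↓ p↓ (¡ (c ⅋ c′)) = _ , rule l-p↓ p↓ , ¡ c ⅋ why (dig (der c′))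
permute-Redex n-e↓ e↓ 𝟙 = _ , rule l-e↓ e↓ , ¡ 𝟙
permute-Redex n-w↓ w↓ 𝟙 = _ , ε , why nil
permute-Redex n-b↓ b↓ (why c ⅋ c′) = _ , ε , why (join c (der c′))
permute-Redex n-g↓ g↓ (why c) = _ , ε , why (↠-dig c)

-- A derivation under a `¿` is copied to every `der` leaf and vanishes at `nil`.
permute-? : (∀ {C} → C ↠ A → Linear⨾↠ C B) → C ↠? A → ∃[ C′ ] Lin ⊥ ⊢ C ⟶ C′ × C′ ↠? B
permute-? f nil = _ , ε , nil
permute-? f (der c) =
  let _ , d , k = f c in _ , d , der k
permute-? f (join c c′) =
  let _ , d , k = permute-? f c ; _ , d′ , k′ = permute-? f c′ in _ , d ⅋ᶜ d′ , join k k′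
permute-? f (dig c) =
  let _ , d , k = permute-? f c in _ , ¿ᶜ d , dig k

permute : NEL ⊢ A ⟶ B → C ↠ A → Linear⨾↠ C B
permute ε c = _ , ε , c
permute (d ⨟ e) c =
  let _ , d′ , k = permute d c ; _ , e′ , k′ = permute e k in _ , d′ ⨟ e′ , k′
permute (ax p)     c = permute-Ax p c
permute (ax⁻ p)    c = permute-Ax⁻ p c
permute (rule x p) c = permute-Redex x p c
permute (d ⅋ᶜ e) (c ⅋ c′) =
  let _ , d′ , k = permute d c ; _ , e′ , k′ = permute e c′ in _ , d′ ⅋ᶜ e′ , k ⅋ k′
permute (d ⊗ᶜ e) (c ⊗ c′) =
  let _ , d′ , k = permute d c ; _ , e′ , k′ = permute e c′ in _ , d′ ⊗ᶜ e′ , k ⊗ k′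
permute (d ⊲ᶜ e) (c ⊲ c′) =
  let _ , d′ , k = permute d c ; _ , e′ , k′ = permute e c′ in _ , d′ ⊲ᶜ e′ , k ⊲ k′
permute (¿ᶜ d) (why c) =
  let _ , d′ , k = permute-? (permute d) c in _ , d′ , why k
permute (¡ᶜ d) (¡ c) =
  let _ , d′ , k = permute d c in _ , ¡ᶜ d′ , ¡ k

-- Separation of weakening, absorption and digging.

infix 4 _▷_ _≈▷_

data _▷_ : Form → Form → Set where
  lit  : ∀ {x} → lit x ▷ lit x
  𝟙    : 𝟙 ▷ 𝟙
  _⅋_  : A ▷ A′ → B ▷ B′ → A ⅋ B ▷ A′ ⅋ B′
  _⊗_  : A ▷ A′ → B ▷ B′ → A ⊗ B ▷ A′ ⊗ B′
  _⊲_  : A ▷ A′ → B ▷ B′ → A ⊲ B ▷ A′ ⊲ B′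
  ¡_   : A ▷ A′ → ¡ A ▷ ¡ A′
  ¿_   : A ▷ A′ → ¿ A ▷ ¿ A′
  nil  : 𝟙 ▷ ¿ B
  abs  : A ▷ ¿ B → A′ ▷ B → A ⅋ A′ ▷ ¿ B

-- Weakenings occur only at `nil` leaves, hence before every absorption that uses them.
▷-split : A ▷ B → ∃[ C ] ⟪ w↓ ⟫ ⊢ A ⟶ C × ⟪ b↓ ⟫ ⊢ C ⟶ B
▷-split lit = _ , ε , ε
▷-split 𝟙   = _ , ε , ε
▷-split (c ⅋ k) =
  let _ , d , e = ▷-split c ; _ , d′ , e′ = ▷-split k in _ , d ⅋ᶜ d′ , e ⅋ᶜ e′
▷-split (c ⊗ k) =
  let _ , d , e = ▷-split c ; _ , d′ , e′ = ▷-split k in _ , d ⊗ᶜ d′ , e ⊗ᶜ e′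
▷-split (c ⊲ k) =
  let _ , d , e = ▷-split c ; _ , d′ , e′ = ▷-split k in _ , d ⊲ᶜ d′ , e ⊲ᶜ e′
▷-split (¡ c) = let _ , d , e = ▷-split c in _ , ¡ᶜ d , ¡ᶜ e
▷-split (¿ c) = let _ , d , e = ▷-split c in _ , ¿ᶜ d , ¿ᶜ e
▷-split nil   = _ , rule refl w↓ , ε
▷-split (abs c k) =
  let _ , d , e = ▷-split c ; _ , d′ , e′ = ▷-split k
  in  _ , d ⅋ᶜ d′ , e ⅋ᶜ e′ ⨟ rule refl b↓

-- The equations in front can insert units, which then serve as places for `nil`.
_≈▷_ : Form → Form → Set
A ≈▷ B = ∃[ A′ ] ∅ ⊢ A ⟶ A′ × A′ ▷ B

≈▷-respˡ : ∅ ⊢ A ⟶ B → B ≈▷ C → A ≈▷ C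
≈▷-respˡ d (_ , e , c) = _ , d ⨟ e , c

¿^ : ℕ → Form → Form
¿^ zero    A = A
¿^ (suc n) A = ¿ ¿^ n A

-- Since w↓ and b↓ derive ¿^ m A from copies of ¿^ k A with k < m, stacking
-- enough ¿'s lets every contraction be done before any g↓.
thicken : ℕ → Form → Form
thicken n (lit x) = lit x
thicken n 𝟙       = 𝟙
thicken n (A ⅋ B) = thicken n A ⅋ thicken n B
thicken n (A ⊗ B) = thicken n A ⊗ thicken n B
thicken n (A ⊲ B) = thicken n A ⊲ thicken n B
thicken n (¿ A)   = ¿^ (suc n) (thicken n A)
thicken n (¡ A)   = ¡ thicken n A

¿^-flatten : ∀ n → ⟪ g↓ ⟫ ⊢ ¿^ (suc n) A ⟶ ¿ A
¿^-flatten zero    = ε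
¿^-flatten (suc n) = ¿ᶜ (¿^-flatten n) ⨟ rule refl g↓

thicken-flatten : ∀ n A → ⟪ g↓ ⟫ ⊢ thicken n A ⟶ A
thicken-flatten n (lit x) = ε
thicken-flatten n 𝟙       = ε
thicken-flatten n (A ⅋ B) = thicken-flatten n A ⅋ᶜ thicken-flatten n B
thicken-flatten n (A ⊗ B) = thicken-flatten n A ⊗ᶜ thicken-flatten n B
thicken-flatten n (A ⊲ B) = thicken-flatten n A ⊲ᶜ thicken-flatten n B
thicken-flatten n (¿ A)   = ¿^-flatten n ⨟ ¿ᶜ (thicken-flatten n A)
thicken-flatten n (¡ A)   = ¡ᶜ (thicken-flatten n A)

≈▷-raise : ∀ m → A ≈▷ B → A ≈▷ ¿^ m B
≈▷-raise zero    c = c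
≈▷-raise (suc m) c =
  let _ , d , k = ≈▷-raise m c in _ , d ⨟ ax⁻ ⅋-unit , abs nil k

≈▷-abs : A ≈▷ ¿ B → A′ ≈▷ B → A ⅋ A′ ≈▷ ¿ B
≈▷-abs (_ , d , c) (_ , e , k) = _ , d ⅋ᶜ e , abs c k

depth  : A ↠ B → ℕ
depth? : A ↠? B → ℕ
depth lit     = 0
depth 𝟙       = 0
depth (c ⅋ k) = depth c + depth k
depth (c ⊗ k) = depth c + depth k
depth (c ⊲ k) = depth c + depth k
depth (¡ c)   = depth c
depth (why c) = depth? c
depth? nil       = 0
depth? (der c)   = suc (depth c)
depth? (join c k) = depth? c + depth? k
-- One level pays for the `¿` of the source and one for its absorption; the third keeps the
-- remaining exponent positive, so that `nil` can start the inner absorption.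
depth? (dig c)   = 3 + depth? c

+≤ˡ : ∀ {m n o} → m + n ≤ o → m ≤ o
+≤ˡ = ≤-trans (m≤m+n _ _)

+≤ʳ : ∀ {n o} m → m + n ≤ o → n ≤ o
+≤ʳ m = ≤-trans (m≤n+m _ m)

↠-thicken  : ∀ {n} (c : A ↠ B) → depth c ≤ n → A ≈▷ thicken n B
-- `C` accumulates what has been absorbed so far, starting from a weakened unit. The exponent `m`
-- falls by two inside each `dig` while the thickness `n` stays fixed, so the depth is bounded by
-- both.
↠?-thicken : ∀ {m n} (c : A ↠? B) → depth? c ≤ m → depth? c ≤ n →
             C ≈▷ ¿^ m (thicken n B) → C ⅋ A ≈▷ ¿^ m (thicken n B)

↠-thicken lit _ = _ , ε , lit
↠-thicken 𝟙   _ = _ , ε , 𝟙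
↠-thicken (c ⅋ k) p =
  let _ , d , c′ = ↠-thicken c (+≤ˡ p) ; _ , e , k′ = ↠-thicken k (+≤ʳ (depth c) p)
  in  _ , d ⅋ᶜ e , c′ ⅋ k′
↠-thicken (c ⊗ k) p =
  let _ , d , c′ = ↠-thicken c (+≤ˡ p) ; _ , e , k′ = ↠-thicken k (+≤ʳ (depth c) p)
  in  _ , d ⊗ᶜ e , c′ ⊗ k′
↠-thicken (c ⊲ k) p =
  let _ , d , c′ = ↠-thicken c (+≤ˡ p) ; _ , e , k′ = ↠-thicken k (+≤ʳ (depth c) p)
  in  _ , d ⊲ᶜ e , c′ ⊲ k′
↠-thicken (¡ c) p = let _ , d , c′ = ↠-thicken c p in _ , ¡ᶜ d , ¡ c′
↠-thicken {n = n} (why c) p =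
  ≈▷-respˡ (ax⁻ ⅋-unit) (↠?-thicken {m = suc n} c (m≤n⇒m≤1+n p) p (_ , ε , nil))

↠?-thicken nil _ _ (_ , d , k) = _ , ⅋-unitʳ ⨟ d , k
↠?-thicken {m = suc m} (der c) _ q k =
  ≈▷-abs k (≈▷-raise m (↠-thicken c (≤-trans (n≤1+n _) q)))
↠?-thicken (join c c′) p q k =
  ≈▷-respˡ (ax⁻ ⅋-assoc)
    (↠?-thicken c′ (+≤ʳ (depth? c) p) (+≤ʳ (depth? c) q) (↠?-thicken c (+≤ˡ p) (+≤ˡ q) k))
↠?-thicken {m = suc (suc (suc m))} (dig c) (s≤s (s≤s p)) q k =
  let _ , d , c′ = ≈▷-respˡ (ax⁻ ⅋-unit)
                     (↠?-thicken {m = suc m} c (≤-trans (n≤1+n _) p) (+≤ʳ 3 q) (_ , ε , nil))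
  in  ≈▷-abs k (_ , ¿ᶜ d , ¿ c′)

↠-split : A ↠ B → ∃[ C ] ∃[ D ] ⟪ w↓ ⟫ ⊢ A ⟶ C × ⟪ b↓ ⟫ ⊢ C ⟶ D × ⟪ g↓ ⟫ ⊢ D ⟶ B
↠-split c =
  let _ , d , k = ↠-thicken c ≤-refl ; _ , e , f = ▷-split k
  in  _ , _ , from-∅ d ⨟ e , f , thicken-flatten (depth c) _

-- Insertions

-- Inserting by a tensor loses no generality: SNELh derives every other way of
-- placing a formula Z, created out of the unit, next to A from A ⊗ Z.

infix 4 _∣_⊑_

data _∣_⊑_ (W : Set) : Form → Form → Set
data New   (W : Set) : Form → Set

data _∣_⊑_ W where
  lit  : ∀ {x} → W ∣ lit x ⊑ lit x
  𝟙    : W ∣ 𝟙 ⊑ 𝟙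
  _⅋_  : W ∣ A ⊑ A′ → W ∣ B ⊑ B′ → W ∣ A ⅋ B ⊑ A′ ⅋ B′
  _⊗_  : W ∣ A ⊑ A′ → W ∣ B ⊑ B′ → W ∣ A ⊗ B ⊑ A′ ⊗ B′
  _⊲_  : W ∣ A ⊑ A′ → W ∣ B ⊑ B′ → W ∣ A ⊲ B ⊑ A′ ⊲ B′
  ¿_   : W ∣ A ⊑ A′ → W ∣ ¿ A ⊑ ¿ A′
  ¡_   : W ∣ A ⊑ A′ → W ∣ ¡ A ⊑ ¡ A′
  ins  : W ∣ A ⊑ B → New W Z → W ∣ A ⊑ B ⊗ Z

-- A `¡` is created as `¡ 𝟙`, so its body is whatever further insertions make of `𝟙`.
data New W where
  new-ai : ∀ x → New W (lit x ⅋ lit (dual x))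
  new-e  : W ∣ 𝟙 ⊑ A → New W (¡ A)
  new-w  : W → New W (¿ A)

private variable
  W : Set

⊑-refl : ∀ A → W ∣ A ⊑ A
⊑-refl (lit x) = lit
⊑-refl 𝟙       = 𝟙
⊑-refl (A ⅋ B) = ⊑-refl A ⅋ ⊑-refl B
⊑-refl (A ⊗ B) = ⊑-refl A ⊗ ⊑-refl B
⊑-refl (A ⊲ B) = ⊑-refl A ⊲ ⊑-refl B
⊑-refl (¿ A)   = ¿ ⊑-refl A
⊑-refl (¡ A)   = ¡ ⊑-refl A

push-⅋ˡ : SNELh ⊢ (A ⅋ B) ⊗ Z ⟶ (A ⊗ Z) ⅋ B
push-⅋ˡ = rule h-s s

push-⅋ʳ : SNELh ⊢ (A ⅋ B) ⊗ Z ⟶ A ⅋ (B ⊗ Z)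
push-⅋ʳ = ax ⅋-comm ⊗ᶜ ε ⨟ rule h-s s ⨟ ax ⅋-comm

push-⊗ˡ : SNELh ⊢ (A ⊗ B) ⊗ Z ⟶ (A ⊗ Z) ⊗ B
push-⊗ˡ = ax ⊗-assoc ⨟ ε ⊗ᶜ ax ⊗-comm ⨟ ax⁻ ⊗-assoc

push-⊗ʳ : SNELh ⊢ (A ⊗ B) ⊗ Z ⟶ A ⊗ (B ⊗ Z)
push-⊗ʳ = ax ⊗-assoc

push-⊲ˡ : SNELh ⊢ (A ⊲ B) ⊗ Z ⟶ (A ⊗ Z) ⊲ B
push-⊲ˡ = ε ⊗ᶜ ax⁻ ⊲-unitʳ ⨟ rule h-q↑ q↑ ⨟ ε ⊲ᶜ ⊗-unitʳ

push-⊲ʳ : SNELh ⊢ (A ⊲ B) ⊗ Z ⟶ A ⊲ (B ⊗ Z)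
push-⊲ʳ = ε ⊗ᶜ ax⁻ ⊲-unitˡ ⨟ rule h-q↑ q↑ ⨟ ⊗-unitʳ ⊲ᶜ ε

_∣_⊑⨾h_ : Set → Form → Form → Set
W ∣ A ⊑⨾h B = ∃[ A′ ] W ∣ A ⊑ A′ × SNELh ⊢ A′ ⟶ B

infix 4 _∣_⊑⨾h_

-- An insertion deep in the target is made at the root instead, and `d` moves it into place
-- afterwards.
insert : New W Z → SNELh ⊢ B ⊗ Z ⟶ C → W ∣ A ⊑⨾h B → W ∣ A ⊑⨾h C
insert z d (_ , i , e) = _ , ins i z , e ⊗ᶜ ε ⨟ d

lift-Ax : Ax A B → W ∣ B ⊑ C → W ∣ A ⊑⨾h C
lift-Ax ⅋-unit  i = _ , 𝟙 ⅋ i , ax ⅋-unit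
lift-Ax ⊗-unit  i = _ , 𝟙 ⊗ i , ax ⊗-unit
lift-Ax ⊲-unitˡ i = _ , 𝟙 ⊲ i , ax ⊲-unitˡ
lift-Ax ⊲-unitʳ i = _ , i ⊲ 𝟙 , ax ⊲-unitʳ
lift-Ax ⅋-assoc (i ⅋ (j ⅋ k))   = _ , (i ⅋ j) ⅋ k , ax ⅋-assoc
lift-Ax ⅋-assoc (i ⅋ ins j z)   = insert z push-⅋ʳ (lift-Ax ⅋-assoc (i ⅋ j))
lift-Ax ⅋-assoc (ins i z)       = insert z ε (lift-Ax ⅋-assoc i)
lift-Ax ⊗-assoc (i ⊗ (j ⊗ k))   = _ , (i ⊗ j) ⊗ k , ax ⊗-assoc
lift-Ax ⊗-assoc (i ⊗ ins j z)   = insert z push-⊗ʳ (lift-Ax ⊗-assoc (i ⊗ j))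
lift-Ax ⊗-assoc (ins i z)       = insert z ε (lift-Ax ⊗-assoc i)
lift-Ax ⊲-assoc (i ⊲ (j ⊲ k))   = _ , (i ⊲ j) ⊲ k , ax ⊲-assoc
lift-Ax ⊲-assoc (i ⊲ ins j z)   = insert z push-⊲ʳ (lift-Ax ⊲-assoc (i ⊲ j))
lift-Ax ⊲-assoc (ins i z)       = insert z ε (lift-Ax ⊲-assoc i)
lift-Ax ⅋-comm  (i ⅋ j)         = _ , j ⅋ i , ax ⅋-comm
lift-Ax ⅋-comm  (ins i z)       = insert z ε (lift-Ax ⅋-comm i)
lift-Ax ⊗-comm  (i ⊗ j)         = _ , j ⊗ i , ax ⊗-comm
lift-Ax ⊗-comm  (ins i z)       = insert z ε (lift-Ax ⊗-comm i)

lift-Ax⁻ : Ax B A → W ∣ B ⊑ C → W ∣ A ⊑⨾h C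
lift-Ax⁻ ⅋-assoc ((i ⅋ j) ⅋ k)   = _ , i ⅋ (j ⅋ k) , ax⁻ ⅋-assoc
lift-Ax⁻ ⅋-assoc (ins i z ⅋ j)   = insert z push-⅋ˡ (lift-Ax⁻ ⅋-assoc (i ⅋ j))
lift-Ax⁻ ⅋-assoc (ins i z)       = insert z ε (lift-Ax⁻ ⅋-assoc i)
lift-Ax⁻ ⊗-assoc ((i ⊗ j) ⊗ k)   = _ , i ⊗ (j ⊗ k) , ax⁻ ⊗-assoc
lift-Ax⁻ ⊗-assoc (ins i z ⊗ j)   = insert z push-⊗ˡ (lift-Ax⁻ ⊗-assoc (i ⊗ j))
lift-Ax⁻ ⊗-assoc (ins i z)       = insert z ε (lift-Ax⁻ ⊗-assoc i)
lift-Ax⁻ ⊲-assoc ((i ⊲ j) ⊲ k)   = _ , i ⊲ (j ⊲ k) , ax⁻ ⊲-assoc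
lift-Ax⁻ ⊲-assoc (ins i z ⊲ j)   = insert z push-⊲ˡ (lift-Ax⁻ ⊲-assoc (i ⊲ j))
lift-Ax⁻ ⊲-assoc (ins i z)       = insert z ε (lift-Ax⁻ ⊲-assoc i)
lift-Ax⁻ ⅋-comm  i               = lift-Ax ⅋-comm i
lift-Ax⁻ ⊗-comm  i               = lift-Ax ⊗-comm i
lift-Ax⁻ ⅋-unit  (𝟙 ⅋ i)         = _ , i , ax⁻ ⅋-unit
lift-Ax⁻ ⅋-unit  (ins i z ⅋ j)   = insert z push-⅋ˡ (lift-Ax⁻ ⅋-unit (i ⅋ j))
lift-Ax⁻ ⅋-unit  (ins i z)       = insert z ε (lift-Ax⁻ ⅋-unit i)
lift-Ax⁻ ⊗-unit  (𝟙 ⊗ i)         = _ , i , ax⁻ ⊗-unit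
lift-Ax⁻ ⊗-unit  (ins i z ⊗ j)   = insert z push-⊗ˡ (lift-Ax⁻ ⊗-unit (i ⊗ j))
lift-Ax⁻ ⊗-unit  (ins i z)       = insert z ε (lift-Ax⁻ ⊗-unit i)
lift-Ax⁻ ⊲-unitˡ (𝟙 ⊲ i)         = _ , i , ax⁻ ⊲-unitˡ
lift-Ax⁻ ⊲-unitˡ (ins i z ⊲ j)   = insert z push-⊲ˡ (lift-Ax⁻ ⊲-unitˡ (i ⊲ j))
lift-Ax⁻ ⊲-unitˡ (ins i z)       = insert z ε (lift-Ax⁻ ⊲-unitˡ i)
lift-Ax⁻ ⊲-unitʳ (i ⊲ 𝟙)         = _ , i , ax⁻ ⊲-unitʳ
lift-Ax⁻ ⊲-unitʳ (i ⊲ ins j z)   = insert z push-⊲ʳ (lift-Ax⁻ ⊲-unitʳ (i ⊲ j))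
lift-Ax⁻ ⊲-unitʳ (ins i z)       = insert z ε (lift-Ax⁻ ⊲-unitʳ i)

lift-Redex : ∀ {r} → Lin W r → Redex r A B → W ∣ B ⊑ C → W ∣ A ⊑⨾h C
lift-Redex l-ai↓ (ai↓ x) (lit ⅋ lit)     = _ , ins 𝟙 (new-ai x) , ax ⊗-unit
lift-Redex l-ai↓ (ai↓ x) (ins i z ⅋ j)   = insert z push-⅋ˡ (lift-Redex l-ai↓ (ai↓ x) (i ⅋ j))
lift-Redex l-ai↓ (ai↓ x) (lit ⅋ ins j z) = insert z push-⅋ʳ (lift-Redex l-ai↓ (ai↓ x) (lit ⅋ j))
lift-Redex l-ai↓ (ai↓ x) (ins i z) = insert z ε (lift-Redex l-ai↓ (ai↓ x) i)
lift-Redex l-s s ((i ⊗ j) ⅋ k)   = _ , (i ⅋ k) ⊗ j , rule h-s s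
lift-Redex l-s s (ins i z ⅋ k)   = insert z push-⅋ˡ (lift-Redex l-s s (i ⅋ k))
lift-Redex l-s s (ins i z) = insert z ε (lift-Redex l-s s i)
lift-Redex l-q↓ q↓ ((i ⊲ j) ⅋ (k ⊲ l)) = _ , (i ⅋ k) ⊲ (j ⅋ l) , rule h-q↓ q↓
lift-Redex l-q↓ q↓ (ins i z ⅋ k)       = insert z push-⅋ˡ (lift-Redex l-q↓ q↓ (i ⅋ k))
lift-Redex l-q↓ q↓ ((i ⊲ j) ⅋ ins k z) = insert z push-⅋ʳ (lift-Redex l-q↓ q↓ ((i ⊲ j) ⅋ k))
lift-Redex l-q↓ q↓ (ins i z) = insert z ε (lift-Redex l-q↓ q↓ i)
lift-Redex l-p↓ p↓ (¡ i ⅋ ¿ j)     = _ , ¡ (i ⅋ j) , rule h-p↓ p↓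
lift-Redex l-p↓ p↓ (ins i z ⅋ k)   = insert z push-⅋ˡ (lift-Redex l-p↓ p↓ (i ⅋ k))
lift-Redex l-p↓ p↓ (¡ i ⅋ ins k z) = insert z push-⅋ʳ (lift-Redex l-p↓ p↓ (¡ i ⅋ k))
lift-Redex l-p↓ p↓ (ins i z) = insert z ε (lift-Redex l-p↓ p↓ i)
lift-Redex l-e↓ e↓ (¡ i)     = _ , ins 𝟙 (new-e i) , ax ⊗-unit
lift-Redex l-e↓ e↓ (ins i z) = insert z ε (lift-Redex l-e↓ e↓ i)
lift-Redex (l-w↓ w) w↓ (¿ i) = _ , ins 𝟙 (new-w w) , ax ⊗-unit
lift-Redex (l-w↓ w) w↓ (ins i z) = insert z ε (lift-Redex (l-w↓ w) w↓ i)

-- Creations rise to the top. The insertion below is arbitrary, since those lifted out of later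
-- steps must still pass the earlier ones.
lift : Lin W ⊢ A ⟶ B → W ∣ B ⊑ C → W ∣ A ⊑⨾h C
lift ε i = _ , i , ε
lift (d ⨟ e) i =
  let _ , j , h = lift e i ; _ , k , h′ = lift d j in _ , k , h′ ⨟ h
lift (ax p)     i = lift-Ax p i
lift (ax⁻ p)    i = lift-Ax⁻ p i
lift (rule l p) i = lift-Redex l p i
lift (d ⅋ᶜ e) (i ⅋ j) =
  let _ , i′ , h = lift d i ; _ , j′ , h′ = lift e j in _ , i′ ⅋ j′ , h ⅋ᶜ h′
lift (d ⅋ᶜ e) (ins i z) = insert z ε (lift (d ⅋ᶜ e) i)
lift (d ⊗ᶜ e) (i ⊗ j) =
  let _ , i′ , h = lift d i ; _ , j′ , h′ = lift e j in _ , i′ ⊗ j′ , h ⊗ᶜ h′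
lift (d ⊗ᶜ e) (ins i z) = insert z ε (lift (d ⊗ᶜ e) i)
lift (d ⊲ᶜ e) (i ⊲ j) =
  let _ , i′ , h = lift d i ; _ , j′ , h′ = lift e j in _ , i′ ⊲ j′ , h ⊲ᶜ h′
lift (d ⊲ᶜ e) (ins i z) = insert z ε (lift (d ⊲ᶜ e) i)
lift (¿ᶜ d) (¿ i)     = let _ , i′ , h = lift d i in _ , ¿ i′ , ¿ᶜ h
lift (¿ᶜ d) (ins i z) = insert z ε (lift (¿ᶜ d) i)
lift (¡ᶜ d) (¡ i)     = let _ , i′ , h = lift d i in _ , ¡ i′ , ¡ᶜ h
lift (¡ᶜ d) (ins i z) = insert z ε (lift (¡ᶜ d) i)

-- Staged derivations

Path : List RuleSet → Form → Form → Set
Path []       A B = A ≡ B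
Path (X ∷ Xs) A B = ∃[ C ] X ⊢ A ⟶ C × Path Xs C B

private variable
  Xs Ys : List RuleSet

path-ε : Path Xs A A
path-ε {Xs = []}    = refl
path-ε {Xs = _ ∷ _} = _ , ε , path-ε

path-map : (f : Form → Form) → (∀ {X A B} → X ⊢ A ⟶ B → X ⊢ f A ⟶ f B) →
           Path Xs A B → Path Xs (f A) (f B)
path-map {Xs = []}    f g refl        = refl
path-map {Xs = _ ∷ _} f g (_ , d , p) = _ , g d , path-map f g p

path-map₂ : (f : Form → Form → Form) →
            (∀ {X A A′ B B′} → X ⊢ A ⟶ A′ → X ⊢ B ⟶ B′ → X ⊢ f A B ⟶ f A′ B′) →
            Path Xs A A′ → Path Xs B B′ → Path Xs (f A B) (f A′ B′)
path-map₂ {Xs = []}    f g refl        refl        = refl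
path-map₂ {Xs = _ ∷ _} f g (_ , d , p) (_ , e , q) = _ , g d e , path-map₂ f g p q

infixr 5 _▸_
_▸_ : Path Xs A B → Path Ys B C → Path (Xs ++ Ys) A C
_▸_ {Xs = []}    refl        q = q
_▸_ {Xs = _ ∷ _} (_ , d , p) q = _ , d , p ▸ q

stage : X ⊢ A ⟶ B → Path (X ∷ []) A B
stage d = _ , d , refl

dual-onto : List Rule → List RuleSet → List RuleSet
dual-onto []       Ys = Ys
dual-onto (r ∷ rs) Ys = dual-onto rs (⟪ dualRule r ⟫ ∷ Ys)

path-dual-onto : ∀ rs → Path (map ⟪_⟫ rs) A B → Path Ys (∼ A) C → Path (dual-onto rs Ys) (∼ B) C
path-dual-onto []       refl        q = q
path-dual-onto (r ∷ rs) (_ , d , p) q =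
  path-dual-onto rs p (_ , dualize (λ { refl → refl }) d , q)

path-dual : ∀ rs → Path (map ⟪_⟫ rs) A B → Path (dual-onto rs []) (∼ B) (∼ A)
path-dual rs p = path-dual-onto rs p refl

-- Only a created `¡` can host further insertions, so all `e↓` go first and the other creations
-- follow in the order fixed by `α` and `ω`.
⊑-stages : (∀ x → Path Xs 𝟙 (lit x ⅋ lit (dual x))) → (W → ∀ A → Path Xs 𝟙 (¿ A)) →
           W ∣ A ⊑ B → Path (⟪ e↓ ⟫ ∷ Xs) A B
New-stages : (∀ x → Path Xs 𝟙 (lit x ⅋ lit (dual x))) → (W → ∀ A → Path Xs 𝟙 (¿ A)) →
             New W Z → Path (⟪ e↓ ⟫ ∷ Xs) 𝟙 Z

⊑-stages α ω lit     = path-ε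
⊑-stages α ω 𝟙       = path-ε
⊑-stages α ω (i ⅋ j) = path-map₂ _⅋_ _⅋ᶜ_ (⊑-stages α ω i) (⊑-stages α ω j)
⊑-stages α ω (i ⊗ j) = path-map₂ _⊗_ _⊗ᶜ_ (⊑-stages α ω i) (⊑-stages α ω j)
⊑-stages α ω (i ⊲ j) = path-map₂ _⊲_ _⊲ᶜ_ (⊑-stages α ω i) (⊑-stages α ω j)
⊑-stages α ω (¿ i)   = path-map ¿_ ¿ᶜ (⊑-stages α ω i)
⊑-stages α ω (¡ i)   = path-map ¡_ ¡ᶜ (⊑-stages α ω i)
⊑-stages α ω (ins i z) =
  let _ , d , p = path-map₂ _⊗_ _⊗ᶜ_ (⊑-stages α ω i) (New-stages α ω z)
  in  _ , ⊗-unitʳ⁻ ⨟ d , p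

New-stages α ω (new-ai x) = _ , ε , α x
New-stages α ω (new-e i)  =
  let _ , d , p = path-map ¡_ ¡ᶜ (⊑-stages α ω i) in _ , rule refl e↓ ⨟ d , p
New-stages α ω (new-w w)  = _ , ε , ω w _

record Staged (rs : List Rule) (A : Form) : Set where
  constructor staged
  field
    {E Q}   : Form
    create  : ⟪ e↓ ⟫ ⊢ 𝟙 ⟶ E
    middle  : Path (map ⟪_⟫ rs) E Q
    shuffle : SNELh ⊢ Q ⟶ A

record Order (W : Set) (rs : List Rule) : Set where
  field
    place-ai : ∀ x → Path (map ⟪_⟫ rs) 𝟙 (lit x ⅋ lit (dual x))
    place-w  : W → ∀ A → Path (map ⟪_⟫ rs) 𝟙 (¿ A)

open Order

order-ai : Order ⊥ (ai↓ ∷ [])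
order-ai .place-ai x = _ , rule refl (ai↓ x) , refl
order-ai .place-w ()

order-w-ai : Order ⊤ (w↓ ∷ ai↓ ∷ [])
order-w-ai .place-ai x  = _ , ε , _ , rule refl (ai↓ x) , refl
order-w-ai .place-w _ A = _ , rule refl w↓ , _ , ε , refl

order-ai-w : Order ⊤ (ai↓ ∷ w↓ ∷ [])
order-ai-w .place-ai x  = _ , rule refl (ai↓ x) , _ , ε , refl
order-ai-w .place-w _ A = _ , ε , _ , rule refl w↓ , refl

stage-proof : ∀ {rs} → Order W rs → Lin W ⊢ 𝟙 ⟶ A → Staged rs A
stage-proof o d =
  let _ , i , h     = lift d (⊑-refl _)
      _ , c , m     = ⊑-stages (place-ai o) (place-w o) i
  in  staged c m h

⅋-⊗-merge : Lin W ⊢ (A ⅋ A′) ⊗ (B ⅋ B′) ⟶ (A ⊗ B) ⅋ (A′ ⅋ B′)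
⅋-⊗-merge =
  rule l-s s ⨟ (ax ⊗-comm ⨟ rule l-s s ⨟ ax ⊗-comm ⅋ᶜ ε) ⅋ᶜ ε ⨟ ax ⅋-assoc ⨟ ε ⅋ᶜ ax ⅋-comm

-- No weakening occurs, so the statement is uniform in `W` and its dual can serve as the cut in all
-- four shapes.
identity : ∀ A → Lin W ⊢ 𝟙 ⟶ A ⅋ ∼ A
identity (lit x) = rule l-ai↓ (ai↓ x)
identity 𝟙       = ax⁻ ⅋-unit
identity (A ⅋ B) =
  ax⁻ ⊗-unit ⨟ (identity A ⨟ ax ⅋-comm) ⊗ᶜ (identity B ⨟ ax ⅋-comm) ⨟ ⅋-⊗-merge ⨟ ax ⅋-comm
identity (A ⊗ B) = ax⁻ ⊗-unit ⨟ identity A ⊗ᶜ identity B ⨟ ⅋-⊗-merge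
identity (A ⊲ B) = ax⁻ ⊲-unitˡ ⨟ identity A ⊲ᶜ identity B ⨟ rule l-q↓ q↓
identity (¿ A)   = rule l-e↓ e↓ ⨟ ¡ᶜ (identity A ⨟ ax ⅋-comm) ⨟ rule l-p↓ p↓ ⨟ ax ⅋-comm
identity (¡ A)   = rule l-e↓ e↓ ⨟ ¡ᶜ (identity A) ⨟ rule l-p↓ p↓

-- A staged proof of C ⅋ D turns into a derivation from ∼ C to D by cutting
-- on C, the cut being the dual of the staged identity on C.  All unit
-- creations take place next to ∼ C and all unit destructions next to D, so
-- they commute with whatever leads to ∼ C or starts from D.
module _ {rs : List Rule} (o : Order W rs) (d : Lin W ⊢ 𝟙 ⟶ C ⅋ D)
         (Us Ds : List RuleSet) (t : Path Us A (∼ C)) (u : Path Ds D B) where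

  private
    module P = Staged (stage-proof o d)
    module N = Staged (stage-proof o (identity {W = W} C))

    begin-e : ⟪ e↓ ⟫ ⊢ U ⟶ U ⊗ P.E
    begin-e = ⊗-unitʳ⁻ ⨟ ε ⊗ᶜ P.create

    end-e : ⟪ e↑ ⟫ ⊢ ∼ N.E ⅋ U ⟶ U
    end-e = dualize (λ { refl → refl }) N.create ⅋ᶜ ε ⨟ ax ⅋-unit

    above : Path (map ⟪_⟫ rs) (∼ C ⊗ P.E) (∼ C ⊗ P.Q)
    above = path-map (∼ C ⊗_) (ε ⊗ᶜ_) P.middle

    below : Path (dual-onto rs []) (∼ N.Q ⅋ D) (∼ N.E ⅋ D)
    below = path-map (_⅋ D) (_⅋ᶜ ε) (path-dual rs N.middle)

    cut : SNELh ⊢ C ⊗ ∼ C ⟶ ∼ N.Q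
    -- `∼ (C ⅋ ∼ C)` computes to `∼ C ⊗ ∼ ∼ C`, hence the transport.
    cut = ax ⊗-comm ⨟
          subst (λ V → SNELh ⊢ ∼ C ⊗ V ⟶ ∼ N.Q) (∼-involutive C) (dualize dual-SNELh N.shuffle)

    core : SNELh ⊢ ∼ C ⊗ P.Q ⟶ ∼ N.Q ⅋ D
    core = ax ⊗-comm ⨟ P.shuffle ⊗ᶜ ε ⨟ rule h-s s ⨟ cut ⅋ᶜ ε

  e-inside : Path (Us ++ (⟪ e↓ ⟫ ∷ []) ++ map ⟪_⟫ rs ++ (SNELh ∷ []) ++
                   dual-onto rs [] ++ (⟪ e↑ ⟫ ∷ []) ++ Ds) A B
  e-inside = t ▸ stage begin-e ▸ above ▸ stage core ▸ below ▸ stage end-e ▸ u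

  -- `P.E` is carried as an inert factor through `t`, and `∼ N.E` likewise through `u`.
  e-outside : Path ((⟪ e↓ ⟫ ∷ []) ++ Us ++ map ⟪_⟫ rs ++ (SNELh ∷ []) ++
                    dual-onto rs [] ++ Ds ++ (⟪ e↑ ⟫ ∷ [])) A B
  e-outside =
    stage begin-e ▸ path-map (_⊗ P.E) (_⊗ᶜ ε) t ▸ above ▸ stage core ▸
    below ▸ path-map (∼ N.E ⅋_) (ε ⅋ᶜ_) u ▸ stage end-e

-- The list is nonempty so that the boundary equations can be absorbed into the first and last
-- stages; an empty `Chain` demands propositional equality.
chain : ∀ {T R} → Path (X ∷ Xs) A B → T ≃ ⌜ A ⌝ → ⌜ B ⌝ ≃ R → Chain (X ∷ Xs) T R
chain {Xs = []} (_ , d , refl) p q =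
  _ , Der-respˡ p (Der-trans (⌜⌝-in hole d) (single q)) , refl
chain {Xs = _ ∷ _} (_ , d , ds) p q =
  _ , Der-respˡ p (⌜⌝-in hole d) , chain ds ≃-refl q

-- Assembly of the four shapes.

dual-from : ∀ rs → Path (map ⟪_⟫ rs) C (∼ A) → Path (dual-onto rs []) A (∼ C)
dual-from {A = A} rs p = subst (λ V → Path (dual-onto rs []) V _) (∼-involutive A) (path-dual rs p)

decompose : X ⊢ A ⟶ B →
            Path shape1 A B × Path shape2 A B × Path shape3 A B × Path shape4 A B
decompose {A = A} d with permute (cut-elimination d) 𝟙
-- The target `∼ A ⅋ B` is not headed by `¿`, so inversion splits the contractions into those of
-- `∼ A` and those of `B`.
... | C ⅋ D , p , c ⅋ k with ↠-split c | ↠-split k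
... | _ , _ , w₁ , b₁ , g₁ | _ , _ , w₂ , b₂ , g₂ =
  e-outside order-ai-w pw _ _ up₂ down₂ ,
  e-inside  order-w-ai pw _ _ up₂ down₂ ,
  e-outside order-ai p _ _ up₃ down₃ ,
  e-inside  order-ai p _ _ up₃ down₃
  where
  up₂   = dual-from {A = A} (b↓ ∷ g↓ ∷ []) (_ , b₁ , _ , g₁ , refl)
  up₃   = dual-from {A = A} (w↓ ∷ b↓ ∷ g↓ ∷ []) (_ , w₁ , _ , b₁ , _ , g₁ , refl)
  down₂ : Path (⟪ b↓ ⟫ ∷ ⟪ g↓ ⟫ ∷ []) _ _
  down₂ = _ , b₂ , _ , g₂ , refl
  down₃ : Path (⟪ w↓ ⟫ ∷ ⟪ b↓ ⟫ ∷ ⟪ g↓ ⟫ ∷ []) _ _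
  down₃ = _ , w₂ , down₂
  widen : ∀ {r} → Lin ⊥ r → Lin ⊤ r
  widen l-ai↓ = l-ai↓
  widen l-s   = l-s
  widen l-q↓  = l-q↓
  widen l-p↓  = l-p↓
  widen l-e↓  = l-e↓
  -- For the first two shapes the weakenings of both halves rejoin the linear proof, so that they
  -- are lifted with its creations.
  pw = ⊢-mono widen p ⨟ ⊢-mono (λ { refl → l-w↓ tt }) w₁ ⅋ᶜ ⊢-mono (λ { refl → l-w↓ tt }) w₂

theorem3p1 : ∀ {T R} → Der SNEL T R →
    Chain shape1 T R × Chain shape2 T R × Chain shape3 T R × Chain shape4 T R
theorem3p1 {T} {R} Δ =
  let p₁ , p₂ , p₃ , p₄ = decompose (nnf-Der Δ)
      finish : ∀ {X Xs} → Path (X ∷ Xs) (nnf T) (nnf R) → Chain (X ∷ Xs) T R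
      finish p = chain p (⌜nnf⌝ T) (≃-sym (⌜nnf⌝ R))
  in  finish p₁ , finish p₂ , finish p₃ , finish p₄
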